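{- Let $c \geq 1$ be a real number and let $G$ be a (possibly infinite) graph whose growth satisfies $f_G(r) \leq cr$ for every positive integer $r$. Then $\operatorname{tw}(G) \leq 49c^2 + 30c$.
   Context: Graphs are undirected and may be infinite. The growth of a graph $G$ is the function $f_G\colon \mathbb{N}\to\mathbb{N}\cup\{\infty\}$ (with $\mathbb{N}$ the positive integers) where $f_G(r)$ is the supremum of $|V(H)|$ over all subgraphs $H$ of $G$ of radius at most $r$. A tree-decomposition of $G$ is a family $(B_x \subseteq V(G) : x\in V(T))$ indexed by the nodes of a tree $T$ such that every edge of $G$ has both ends in some bag $B_x$, and for every vertex $v$ the set $\{x : v\in B_x\}$ induces a non-empty subtree of $T$. Its width is the maximum bag size minus $1$. The treewidth $\operatorname{tw}(G)$ is the minimum width of a tree-decomposition of $G$, or $\infty$ if no tree-decomposition of finite width exists. -}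

module Defs where

open import Level as Level using (Level)
open import Data.Fin.Base using (Fin; zero; suc; fromℕ; inject₁)
open import Data.Integer.Base as ℤ using (ℤ; +_)
open import Data.List.Base using (length)
open import Data.List.Membership.Propositional using () renaming (_∈_ to _∈ₗ_)
open import Data.List.Relation.Unary.Unique.Propositional using (Unique)
open import Data.Nat.Base as ℕ using (ℕ; NonZero)
import Data.Nat.Properties as ℕ
open import Data.Unit.Polymorphic.Base using (⊤)
open import Data.Product.Base using (Σ; ∃; _×_; _,_; proj₁; proj₂)
open import Data.Rational.Base
  using (ℚ; 0ℚ; 1ℚ; ½; _+_; _*_; _-_; 1/_; ∣_∣; _≤_; _<_; _/_; Positive; positive; nonNegative)
  renaming (NonZero to ℚ-NonZero)
import Data.Rational.Properties as ℚ
open import Data.Rational.Solver using (module +-*-Solver)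
open import Function.Bundles using (_⇔_)
open import Function.Definitions using (Injective)
open import Relation.Binary.Core using (Rel; _⇒_)
open import Relation.Binary.Definitions using (Symmetric; Irreflexive)
open import Relation.Binary.PropositionalEquality.Core
  using (_≡_; refl; sym; subst; cong)
import Relation.Binary.Construct.Add.Supremum.NonStrict as Supremum
open import Relation.Nullary.Construct.Add.Supremum using (_⁺; ⊤⁺; [_])
open import Relation.Nullary.Negation.Core using (¬_)
open import Relation.Unary using (Pred; _∈_)

open Supremum ℕ._≤_ using () renaming (_≤⁺_ to _≤ℕ⁺_)

private variable
  a ℓ : Level

------------------------------------------------------------------------
-- Real numbers

-- A real number is represented by a Cauchy sequence of rationals.  The
-- order below is that of the represented reals: two sequences denote the
-- same real exactly when each is ≤ℝ the other.

IsCauchy : (ℕ → ℚ) → Set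
IsCauchy x = ∀ ε → 0ℚ < ε →
  ∃ λ N → ∀ m n → N ℕ.≤ m → N ℕ.≤ n → ∣ x m - x n ∣ ≤ ε

record ℝ : Set where
  constructor mkℝ
  field
    seq    : ℕ → ℚ
    cauchy : IsCauchy seq

open ℝ public

infix 4 _≤ℝ_

_≤ℝ_ : ℝ → ℝ → Set
x ≤ℝ y = ∀ ε → 0ℚ < ε → ∃ λ N → ∀ n → N ℕ.≤ n → seq x n ≤ seq y n + ε

fromℚ : ℚ → ℝ
fromℚ q = mkℝ (λ _ → q) λ ε 0<ε → 0 , λ _ _ _ _ →
  subst (λ d → ∣ d ∣ ≤ ε) (sym (ℚ.+-inverseʳ q)) (ℚ.<⇒≤ 0<ε)

fromℤ : ℤ → ℝ
fromℤ i = fromℚ (i / 1)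

private
  module _ where
    open +-*-Solver

    sum-difference : ∀ p q r s → (p + q) - (r + s) ≡ (p - r) + (q - s)
    sum-difference = solve 4 (λ p q r s →
      (p :+ q) :+ (:- (r :+ s)) := (p :+ (:- r)) :+ (q :+ (:- s))) refl

    add-difference : ∀ p q → p ≡ q + (p - q)
    add-difference = solve 2 (λ p q → p := q :+ (p :+ (:- q))) refl

    product-difference : ∀ p q r s → p * q - r * s ≡ p * (q - s) + (p - r) * s
    product-difference = solve 4 (λ p q r s →
      p :* q :+ (:- (r :* s)) := p :* (q :+ (:- s)) :+ (p :+ (:- r)) :* s) refl

  open ℚ.≤-Reasoning

  +-cauchy : ∀ {x y} → IsCauchy x → IsCauchy y → IsCauchy (λ n → x n + y n)
  +-cauchy {x} {y} cx cy ε 0<ε = M ℕ.⊔ N , λ m n m≥ n≥ → begin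
    ∣ (x m + y m) - (x n + y n) ∣
      ≡⟨ cong ∣_∣ (sum-difference (x m) (y m) (x n) (y n)) ⟩
    ∣ (x m - x n) + (y m - y n) ∣
      ≤⟨ ℚ.∣p+q∣≤∣p∣+∣q∣ (x m - x n) (y m - y n) ⟩
    ∣ x m - x n ∣ + ∣ y m - y n ∣
      ≤⟨ ℚ.+-mono-≤
           (proj₂ (cx δ 0<δ) m n (ℕ.m⊔n≤o⇒m≤o M N m≥) (ℕ.m⊔n≤o⇒m≤o M N n≥))
           (proj₂ (cy δ 0<δ) m n (ℕ.m⊔n≤o⇒n≤o M N m≥) (ℕ.m⊔n≤o⇒n≤o M N n≥)) ⟩
    δ + δ
      ≡⟨ ℚ.*-distribʳ-+ ε ½ ½ ⟨
    1ℚ * ε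
      ≡⟨ ℚ.*-identityˡ ε ⟩
    ε ∎
    where
    δ = ½ * ε
    0<δ : 0ℚ < δ
    0<δ = ℚ.*-monoʳ-<-pos ½ 0<ε
    M = proj₁ (cx δ 0<δ)
    N = proj₁ (cy δ 0<δ)

  EventuallyBoundedBy : (ℕ → ℚ) → ℚ → Set
  EventuallyBoundedBy x B = ∃ λ N → ∀ n → N ℕ.≤ n → ∣ x n ∣ ≤ B

  bounded : ∀ {x} → IsCauchy x → ∃ λ B → 0ℚ < B × EventuallyBoundedBy x B
  bounded {x} cx = ∣ x N ∣ + 1ℚ , 0<B , N , λ n n≥ → begin
    ∣ x n ∣
      ≡⟨ cong ∣_∣ (add-difference (x n) (x N)) ⟩
    ∣ x N + (x n - x N) ∣
      ≤⟨ ℚ.∣p+q∣≤∣p∣+∣q∣ (x N) (x n - x N) ⟩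
    ∣ x N ∣ + ∣ x n - x N ∣
      ≤⟨ ℚ.+-monoʳ-≤ ∣ x N ∣ (proj₂ (cx 1ℚ 0<1) n N n≥ ℕ.≤-refl) ⟩
    ∣ x N ∣ + 1ℚ ∎
    where
    0<1 : 0ℚ < 1ℚ
    0<1 = ℚ.positive⁻¹ 1ℚ
    N = proj₁ (cx 1ℚ 0<1)
    0<B : 0ℚ < ∣ x N ∣ + 1ℚ
    0<B = ℚ.+-mono-≤-< (ℚ.0≤∣p∣ (x N)) 0<1

  ∣*∣-mono : ∀ p q {r s} → ∣ p ∣ ≤ r → ∣ q ∣ ≤ s → ∣ p * q ∣ ≤ r * s
  ∣*∣-mono p q {r} {s} p≤r q≤s = begin
    ∣ p * q ∣      ≡⟨ ℚ.∣p*q∣≡∣p∣*∣q∣ p q ⟩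
    ∣ p ∣ * ∣ q ∣  ≤⟨ ℚ.*-monoʳ-≤-nonNeg ∣ q ∣ {{ℚ.∣-∣-nonNeg q}} p≤r ⟩
    r * ∣ q ∣      ≤⟨ ℚ.*-monoˡ-≤-nonNeg r {{nonNegative (ℚ.≤-trans (ℚ.0≤∣p∣ p) p≤r)}} q≤s ⟩
    r * s          ∎

  divide : ∀ p q → 0ℚ < p → 0ℚ < q → ∃ λ r → 0ℚ < r × r * q ≡ p
  divide p q 0<p 0<q = p * r , 0<pr , (begin-equality
    p * r * q    ≡⟨ ℚ.*-assoc p r q ⟩
    p * (r * q)  ≡⟨ cong (p *_) (ℚ.*-inverseˡ q) ⟩
    p * 1ℚ       ≡⟨ ℚ.*-identityʳ p ⟩
    p            ∎)
    where
    instance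
      p-pos : Positive p
      p-pos = positive 0<p
      q-pos : Positive q
      q-pos = positive 0<q
      q-nonZero : ℚ-NonZero q
      q-nonZero = ℚ.pos⇒nonZero q
    r : ℚ
    r = 1/ q
    0<pr : 0ℚ < p * r
    0<pr = ℚ.positive⁻¹ (p * r) {{ℚ.pos*pos⇒pos p r {{ℚ.1/pos⇒pos q}}}}

  product-close : ∀ p q r s {B C δ} → ∣ p ∣ ≤ B → ∣ s ∣ ≤ C →
    ∣ p - r ∣ ≤ δ → ∣ q - s ∣ ≤ δ → ∣ p * q - r * s ∣ ≤ δ * (B + C)
  product-close p q r s {B} {C} {δ} p≤B s≤C p-r≤δ q-s≤δ = begin
    ∣ p * q - r * s ∣                  ≡⟨ cong ∣_∣ (product-difference p q r s) ⟩
    ∣ p * (q - s) + (p - r) * s ∣      ≤⟨ ℚ.∣p+q∣≤∣p∣+∣q∣ (p * (q - s)) ((p - r) * s) ⟩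
    ∣ p * (q - s) ∣ + ∣ (p - r) * s ∣  ≤⟨ ℚ.+-mono-≤ (∣*∣-mono p (q - s) p≤B q-s≤δ)
                                                     (∣*∣-mono (p - r) s p-r≤δ s≤C) ⟩
    B * δ + δ * C                      ≡⟨ cong (_+ δ * C) (ℚ.*-comm B δ) ⟩
    δ * B + δ * C                      ≡⟨ ℚ.*-distribˡ-+ δ B C ⟨
    δ * (B + C)                        ∎

  *-cauchy : ∀ {x y} → IsCauchy x → IsCauchy y → IsCauchy (λ n → x n * y n)
  *-cauchy {x} {y} cx cy ε 0<ε =
    let B , 0<B , K , x≤B = bounded cx
        C , 0<C , L , y≤C = bounded cy
        δ , 0<δ , δ*[B+C]≡ε = divide ε (B + C) 0<ε (ℚ.+-mono-< 0<B 0<C)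
        M , x-close = cx δ 0<δ
        N , y-close = cy δ 0<δ
    in (M ℕ.⊔ N) ℕ.⊔ (K ℕ.⊔ L) , λ m n m≥ n≥ →
      let M⊔N≤m = ℕ.m⊔n≤o⇒m≤o (M ℕ.⊔ N) (K ℕ.⊔ L) m≥
          M⊔N≤n = ℕ.m⊔n≤o⇒m≤o (M ℕ.⊔ N) (K ℕ.⊔ L) n≥
          K⊔L≤m = ℕ.m⊔n≤o⇒n≤o (M ℕ.⊔ N) (K ℕ.⊔ L) m≥
          K⊔L≤n = ℕ.m⊔n≤o⇒n≤o (M ℕ.⊔ N) (K ℕ.⊔ L) n≥
      in subst (∣ x m * y m - x n * y n ∣ ≤_) δ*[B+C]≡ε
        (product-close (x m) (y m) (x n) (y n)
          (x≤B m (ℕ.m⊔n≤o⇒m≤o K L K⊔L≤m))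
          (y≤C n (ℕ.m⊔n≤o⇒n≤o K L K⊔L≤n))
          (x-close m n (ℕ.m⊔n≤o⇒m≤o M N M⊔N≤m) (ℕ.m⊔n≤o⇒m≤o M N M⊔N≤n))
          (y-close m n (ℕ.m⊔n≤o⇒n≤o M N M⊔N≤m) (ℕ.m⊔n≤o⇒n≤o M N M⊔N≤n)))

infixl 6 _+ℝ_
infixl 7 _*ℝ_

_+ℝ_ : ℝ → ℝ → ℝ
x +ℝ y = mkℝ (λ n → seq x n + seq y n) (+-cauchy {seq x} {seq y} (cauchy x) (cauchy y))

_*ℝ_ : ℝ → ℝ → ℝ
x *ℝ y = mkℝ (λ n → seq x n * seq y n) (*-cauchy {seq x} {seq y} (cauchy x) (cauchy y))

open Supremum _≤ℝ_ public using () renaming (_≤⁺_ to _≤ℝ⁺_)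

------------------------------------------------------------------------
-- Cardinalities in ℕ ∪ {∞}

HasFiniteSize : {A : Set a} → Pred A ℓ → ℕ → Set _
HasFiniteSize P n = ∃ λ xs →
  Unique xs × (∀ x → (x ∈ P) ⇔ (x ∈ₗ xs)) × length xs ≡ n

HasSize : {A : Set a} → Pred A ℓ → ℕ ⁺ → Set _
HasSize P [ n ] = HasFiniteSize P n
HasSize P ⊤⁺    = ¬ ∃ (HasFiniteSize P)

IsUpperBound : Pred (ℕ ⁺) ℓ → ℕ ⁺ → Set _
IsUpperBound S b = ∀ s → s ∈ S → s ≤ℕ⁺ b

IsMaximum : Pred (ℕ ⁺) ℓ → ℕ ⁺ → Set _
IsMaximum S m = m ∈ S × IsUpperBound S m

IsSupremum : Pred (ℕ ⁺) ℓ → ℕ ⁺ → Set _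
IsSupremum S m = IsUpperBound S m × (∀ b → IsUpperBound S b → m ≤ℕ⁺ b)

------------------------------------------------------------------------
-- Graphs and subgraphs

record Graph ℓ : Set (Level.suc ℓ) where
  infix 4 _~_
  field
    Vertex : Set ℓ
    _~_    : Rel Vertex ℓ
    ~-sym  : Symmetric _~_
    ~-irr  : Irreflexive _≡_ _~_

open Graph public using (Vertex)

record Subgraph (G : Graph ℓ) : Set (Level.suc ℓ) where
  open Graph G using (_~_)
  field
    V     : Pred (Vertex G) ℓ
    E     : Rel (Vertex G) ℓ
    E-sym : Symmetric E
    E⇒~   : E ⇒ _~_
    E⇒V   : ∀ {u v} → E u v → u ∈ V × v ∈ V

induced : (G : Graph ℓ) → Pred (Vertex G) ℓ → Subgraph G
induced G P = record
  { V     = P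
  ; E     = λ u v → u ∈ P × v ∈ P × u ~ v
  ; E-sym = λ (p , q , e) → q , p , ~-sym e
  ; E⇒~   = λ (_ , _ , e) → e
  ; E⇒V   = λ (p , q , _) → p , q
  }
  where open Graph G

data Walk {A : Set a} (E : Rel A ℓ) : ℕ → A → A → Set (a Level.⊔ ℓ) where
  []  : ∀ {u} → Walk E 0 u u
  _∷_ : ∀ {n u v w} → E u v → Walk E n v w → Walk E (ℕ.suc n) u w

module _ {G : Graph ℓ} (H : Subgraph G) where
  open Subgraph H

  RadiusAtMost : ℕ → Set ℓ
  RadiusAtMost r = ∃ λ c → c ∈ V ×
    (∀ v → v ∈ V → ∃ λ n → n ℕ.≤ r × Walk E n c v)

  Connected : Set ℓ
  Connected = ∀ u v → u ∈ V → v ∈ V → ∃ λ n → Walk E n u v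

  Cycle : Set ℓ
  Cycle = ∃ λ k → Σ (Fin (3 ℕ.+ k) → Vertex G) λ f →
    Injective _≡_ _≡_ f ×
    (∀ (i : Fin (2 ℕ.+ k)) → E (f (inject₁ i)) (f (suc i))) ×
    E (f (fromℕ (2 ℕ.+ k))) (f zero)

  IsTree : Set ℓ
  IsTree = ∃ V × Connected × ¬ Cycle

-- f is the growth of G: the growth has the positive integers as its domain.
IsGrowth : Graph ℓ → (∀ r → .{{NonZero r}} → ℕ ⁺) → Set _
IsGrowth G f = ∀ r → .{{_ : NonZero r}} → IsSupremum
  (λ s → Σ (Subgraph G) λ H → RadiusAtMost H r × HasSize (Subgraph.V H) s) (f r)

------------------------------------------------------------------------
-- Treewidth

record TreeDecomposition (G : Graph ℓ) : Set (Level.suc ℓ) where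
  open Graph G using (_~_)
  field
    T        : Graph ℓ
    T-tree   : IsTree (induced T (λ _ → ⊤))
    bag      : Vertex T → Pred (Vertex G) ℓ
    edges    : ∀ {u v} → u ~ v → ∃ λ x → u ∈ bag x × v ∈ bag x
    subtrees : ∀ v → IsTree (induced T (λ x → v ∈ bag x))

module _ {G : Graph ℓ} where

  BagSize : TreeDecomposition G → Pred (ℕ ⁺) ℓ
  BagSize D s = ∃ λ x → HasSize (bag x) s
    where open TreeDecomposition D

  -- Finite widths only.  They are integers because the bags of the empty
  -- graph give width -1.
  HasWidth : TreeDecomposition G → ℤ → Set _
  HasWidth D k = ∃ λ m → IsMaximum (BagSize D) [ m ] × k ≡ + m ℤ.- + 1

IsTreewidth : Graph ℓ → ℤ ⁺ → Set _
IsTreewidth G [ k ] =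
  (Σ (TreeDecomposition G) λ D → HasWidth D k) ×
  (∀ (D : TreeDecomposition G) j → HasWidth D j → k ℤ.≤ j)
IsTreewidth G ⊤⁺ = ¬ Σ (TreeDecomposition G) λ D → ∃ (HasWidth D)

{-# OPTIONS --safe #-}

-- Let C ≤ 2 c be an integer with f r ≤ C r for all r.  Given a part U of the
-- graph with a boundary W of k = 10 C² + 2 C + 1 vertices, all in one component
-- of U (otherwise a component of U splits W with S empty), take the least h
-- for which some ball of radius 2 h around a vertex v of W contains more than
-- 2 C vertices of W.  By the linear growth some layer S at distance
-- 2 h + 1, …, 4 h from v has at most 2 C vertices, and the ball I inside that
-- layer is covered by 5 C balls of radius 2 (h - 1), which contain at most
-- 2 C vertices of W each.  So S separates I from the rest of U in such a way
-- that both sides have less than k boundary vertices, and W ∪ S, of size at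
-- most 10 C² + 4 C + 1, is a bag.  A part with a smaller boundary is enlarged
-- by one vertex of U at a time, chosen so that every vertex is eventually
-- reached.  The resulting infinite tree of parts gives a decomposition of
-- width at most 10 C² + 4 C ≤ 40 c² + 8 c.
module Submission where

open import Defs
open import Axiom.ExcludedMiddle using (ExcludedMiddle)
open import Axiom.Extensionality.Propositional using (Extensionality)
open import Data.Bool.Base using (Bool; true; false)
import Data.Empty.Polymorphic as Empty
open import Data.Fin.Base as Fin using (Fin; zero; suc; inject₁; fromℕ; toℕ)
import Data.Fin.Properties as Fin
open import Data.Fin.Relation.Unary.Top using (view; ‵fromℕ; ‵inject₁)
open import Data.Integer.Base as ℤ using (ℤ; +_)
import Data.Integer.Properties as ℤ
import Data.Integer.Tactic.RingSolver as ℤSolver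
open import Data.List.Base using (List; []; _∷_; _++_; length; filter; upTo; deduplicate)
open import Data.List.Membership.Propositional using (lose) renaming (_∈_ to _∈ₗ_; _∉_ to _∉ₗ_)
open import Data.List.Membership.Propositional.Properties
  using (∈-filter⁺; ∈-filter⁻; ∈-deduplicate⁺; ∈-deduplicate⁻; ∈-++⁺ˡ; ∈-++⁺ʳ; ∈-++⁻; ∈-upTo⁻)
open import Data.List.Properties
  using (length-filter; length-deduplicate; filter-some; filter-all; length-upTo; length-++;
         ∷-injectiveʳ)
open import Data.List.Relation.Unary.All as All using (All; []; _∷_)
open import Data.List.Relation.Unary.AllPairs as AllPairs using (AllPairs; []; _∷_)
open import Data.List.Relation.Unary.Any using (here; there)
open import Data.List.Relation.Unary.Unique.DecPropositional.Properties using (deduplicate-!)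
open import Data.List.Relation.Unary.Unique.Propositional using (Unique)
import Data.List.Relation.Unary.Unique.Propositional.Properties as Unique
open import Data.Maybe.Base using (Maybe; just; nothing; map)
open import Data.Nat.Base as ℕ using (ℕ; zero; suc; _+_; _*_; _≤_; _<_; z≤n; s≤s; NonZero)
open import Data.Nat.Induction using (<-rec)
import Data.Nat.Properties as ℕ
open import Data.Nat.Tactic.RingSolver using (solve-∀)
open import Data.Product.Base using (Σ; ∃; _×_; _,_; proj₁; proj₂)
open import Data.Rational.Base as ℚ using (ℚ; 0ℚ; 1ℚ; ½)
import Data.Rational.Properties as ℚ
open import Data.Rational.Solver using (module +-*-Solver)
open import Data.Rational.Unnormalised.Base as ℚᵘ using (mkℚᵘ; *≡*; *≤*)
import Data.Rational.Unnormalised.Properties as ℚᵘ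
open import Data.Sum.Base as Sum using (_⊎_; inj₁; inj₂)
open import Data.Unit.Base using (⊤; tt)
import Data.Unit.Polymorphic.Base as Poly
open import Function.Base using (_∘_; id)
open import Function.Bundles using (_⇔_; mk⇔; Equivalence)
open import Level as Level using (Level)
open import Relation.Binary.Construct.Add.Supremum.NonStrict _≤_
  using ([≤]-injective) renaming (_≤⁺_ to _≤ℕ⁺_)
open import Relation.Binary.Construct.Add.Supremum.NonStrict using ([_])
open import Relation.Binary.Core using (Rel)
open import Relation.Binary.Definitions using (DecidableEquality; Symmetric)
open import Relation.Binary.PropositionalEquality
  using (_≡_; _≢_; refl; sym; trans; cong; cong₂; subst; subst₂)
open import Relation.Nullary using (¬_; Dec; yes; no; does; contradiction)
open import Relation.Nullary.Construct.Add.Supremum using (_⁺; ⊤⁺; [_])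
open import Relation.Nullary.Decidable using (does-⇔)
open import Relation.Unary using (Pred; Decidable)

private variable
  a b p q ℓ : Level

-- Classical tools: extremal numbers, counting in lists, packing and covering.

module Classical (lem : ∀ {a} → ExcludedMiddle a) where

  decide : {A : Set a} (P : Pred A p) → Decidable P
  decide P x = lem {P = P x}

  infix 4 _≟_
  _≟_ : {A : Set a} → DecidableEquality A
  x ≟ y = lem

  stable : {A : Set a} → ¬ ¬ A → A
  stable {A = A} ¬¬x with lem {P = A}
  ... | yes x = x
  ... | no ¬x = contradiction ¬x ¬¬x

  IsLeast : Pred ℕ p → Pred ℕ p
  IsLeast P n = P n × ∀ m → P m → n ≤ m

  least : (P : Pred ℕ p) → ∃ P → ∃ (IsLeast P)
  least P (n , Pn) = <-rec (λ n → P n → ∃ (IsLeast P)) go n Pn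
    where
    go : ∀ n → (∀ {m} → m < n → P m → ∃ (IsLeast P)) → P n → ∃ (IsLeast P)
    go n rec Pn with lem {P = ∃ λ m → m < n × P m}
    ... | yes (m , m<n , Pm) = rec m<n Pm
    ... | no none = n , Pn , λ m Pm → ℕ.≮⇒≥ λ m<n → none (m , m<n , Pm)

  -- The least upper bound is attained, since otherwise its predecessor would be an upper bound as
  -- well.
  greatest : (P : Pred ℕ p) → ∃ P → ∀ b → (∀ m → P m → m ≤ b) →
    ∃ λ n → P n × ∀ m → P m → m ≤ n
  greatest P (k , Pk) b P≤b with least (λ n → ∀ m → P m → m ≤ n) (b , P≤b)
  ... | n , P≤n , min = n , stable (λ ¬Pn → ¬bound n P≤n min ¬Pn) , P≤n
    where
    ¬bound : ∀ n → (∀ m → P m → m ≤ n) →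
      (∀ i → (∀ m → P m → m ≤ i) → n ≤ i) → ¬ ¬ P n
    ¬bound zero    P≤ min ¬P = ¬P (subst P (ℕ.n≤0⇒n≡0 (P≤ k Pk)) Pk)
    ¬bound (suc n) P≤ min ¬P = ℕ.1+n≰n (min n λ m Pm →
      ℕ.≤-pred (ℕ.≤∧≢⇒< (P≤ m Pm) λ { refl → ¬P Pm }))

  count : {A : Set a} → Pred A p → List A → ℕ
  count P xs = length (filter (decide P) xs)

  module _ {A : Set a} where

    count-mono : {P : Pred A p} {Q : Pred A q} → (∀ {x} → P x → Q x) →
      ∀ xs → count P xs ≤ count Q xs
    count-mono P⊆Q [] = z≤n
    count-mono {P = P} {Q} P⊆Q (x ∷ xs) with decide P x | decide Q x
    ... | yes _  | yes _ = s≤s (count-mono P⊆Q xs)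
    ... | yes Px | no ¬Qx = contradiction (P⊆Q Px) ¬Qx
    ... | no _   | yes _ = ℕ.m≤n⇒m≤1+n (count-mono P⊆Q xs)
    ... | no _   | no _  = count-mono P⊆Q xs

    count-strict : {P : Pred A p} {Q : Pred A q} → (∀ {x} → P x → Q x) →
      ∀ {x xs} → x ∈ₗ xs → Q x → ¬ P x → count P xs < count Q xs
    count-strict {P = P} {Q} P⊆Q {xs = x ∷ xs} (here refl) Qx ¬Px with decide P x | decide Q x
    ... | yes Px | _ = contradiction Px ¬Px
    ... | no _   | yes _ = s≤s (count-mono P⊆Q xs)
    ... | no _   | no ¬Qx = contradiction Qx ¬Qx
    count-strict {P = P} {Q} P⊆Q {xs = y ∷ xs} (there x∈) Qx ¬Px with decide P y | decide Q y
    ... | yes _  | yes _ = s≤s (count-strict P⊆Q x∈ Qx ¬Px)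
    ... | yes Py | no ¬Qy = contradiction (P⊆Q Py) ¬Qy
    ... | no _   | yes _ = ℕ.m≤n⇒m≤1+n (count-strict P⊆Q x∈ Qx ¬Px)
    ... | no _   | no _  = count-strict P⊆Q x∈ Qx ¬Px

    count-∁ : (P : Pred A p) → ∀ xs → count P xs + count (λ x → ¬ P x) xs ≡ length xs
    count-∁ P [] = refl
    count-∁ P (x ∷ xs) with decide P x | decide (λ x → ¬ P x) x
    ... | yes _  | no _   = cong suc (count-∁ P xs)
    ... | no _   | yes _  = trans (ℕ.+-suc _ _) (cong suc (count-∁ P xs))
    ... | yes Px | yes ¬Px = contradiction Px ¬Px
    ... | no ¬Px | no ¬¬Px = contradiction ¬Px ¬¬Px

    count-filter : (P : Pred A p) (Q : Pred A q) → ∀ xs →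
      count P (filter (decide Q) xs) ≤ count P xs
    count-filter P Q [] = z≤n
    count-filter P Q (x ∷ xs) with decide Q x
    ... | no _ with decide P x
    ... | yes _ = ℕ.m≤n⇒m≤1+n (count-filter P Q xs)
    ... | no _  = count-filter P Q xs
    count-filter P Q (x ∷ xs) | yes _ with decide P x
    ... | yes _ = s≤s (count-filter P Q xs)
    ... | no _  = count-filter P Q xs

    count-filter-⊆ : {P : Pred A p} {Q : Pred A q} → (∀ {x} → P x → Q x) → ∀ xs →
      count P xs ≤ count P (filter (decide Q) xs)
    count-filter-⊆ P⊆Q [] = z≤n
    count-filter-⊆ {P = P} {Q} P⊆Q (x ∷ xs) with decide P x | decide Q x
    ... | yes Px | no ¬Qx = contradiction (P⊆Q Px) ¬Qx
    ... | no _   | no _  = count-filter-⊆ P⊆Q xs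
    ... | yes Px | yes _ with decide P x
    ...   | yes _ = s≤s (count-filter-⊆ P⊆Q xs)
    ...   | no ¬Px = contradiction Px ¬Px
    count-filter-⊆ {P = P} {Q} P⊆Q (x ∷ xs) | no ¬Px | yes _ with decide P x
    ...   | yes Px = contradiction Px ¬Px
    ...   | no _  = count-filter-⊆ P⊆Q xs

    count-all : {P : Pred A p} → ∀ {xs} → (∀ {x} → x ∈ₗ xs → P x) → count P xs ≡ length xs
    count-all {P = P} all = cong length (filter-all (decide P) (All.tabulate all))

    count-some : {P : Pred A p} → ∀ {x xs} → x ∈ₗ xs → P x → 1 ≤ count P xs
    count-some {P = P} x∈ Px = filter-some (decide P) (lose x∈ Px)

    -- Induction on `ys`: removing the points of `B y` from `zs` costs the later sets nothing,
    -- because they are disjoint from `B y`.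
    packing : {J : Set b} (B : J → Pred A p) → ∀ {h} ys zs →
      AllPairs (λ i j → ∀ {x} → B i x → ¬ B j x) ys →
      (∀ {j} → j ∈ₗ ys → h ≤ count (B j) zs) → length ys * h ≤ length zs
    packing B [] zs _ _ = z≤n
    packing B {h} (y ∷ ys) zs (y# ∷ #) large = begin
      h + length ys * h          ≤⟨ ℕ.+-mono-≤ (large (here refl)) rest ⟩
      count (B y) zs + count ∁By zs  ≡⟨ count-∁ (B y) zs ⟩
      length zs ∎
      where
      open ℕ.≤-Reasoning
      ∁By : Pred A _
      ∁By x = ¬ B y x
      rest : length ys * h ≤ count ∁By zs
      rest = packing B ys (filter (decide ∁By) zs) # λ {j} j∈ →
        ℕ.≤-trans (large (there j∈))
          (count-filter-⊆ (λ Bjx Byx → All.lookup y# j∈ Byx Bjx) zs)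

    -- Dual to `packing`: after the points of `B y` are removed, the remaining sets cover what is
    -- left.
    covering : {J : Set b} (B : J → Pred A p) → ∀ {h} ys zs →
      (∀ {z} → z ∈ₗ zs → ∃ λ j → j ∈ₗ ys × B j z) →
      (∀ {j} → j ∈ₗ ys → count (B j) zs ≤ h) → length zs ≤ length ys * h
    covering B [] [] cover small = z≤n
    covering B [] (z ∷ zs) cover small with cover (here refl)
    ... | _ , () , _
    covering B {h} (y ∷ ys) zs cover small = begin
      length zs                      ≡⟨ count-∁ (B y) zs ⟨
      count (B y) zs + count ∁By zs  ≤⟨ ℕ.+-mono-≤ (small (here refl)) rest ⟩
      h + length ys * h ∎
      where
      open ℕ.≤-Reasoning
      ∁By : Pred A _
      ∁By x = ¬ B y x
      cover′ : ∀ {z} → z ∈ₗ filter (decide ∁By) zs → ∃ λ j → j ∈ₗ ys × B j z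
      cover′ z∈ with ∈-filter⁻ (decide ∁By) z∈
      ... | z∈zs , ¬Byz with cover z∈zs
      ... | j , there j∈ , Bjz = j , j∈ , Bjz
      ... | j , here refl , Bjz = contradiction Bjz ¬Byz
      rest : count ∁By zs ≤ length ys * h
      rest = covering B ys (filter (decide ∁By) zs) cover′ λ {j} j∈ →
        ℕ.≤-trans (count-filter (B j) ∁By zs) (small (there j∈))

    unique-length : ∀ {xs ys : List A} → Unique xs → (∀ {x} → x ∈ₗ xs → x ∈ₗ ys) →
      length xs ≤ length ys
    unique-length {xs} {ys} uniq xs⊆ys = subst (_≤ length ys) (ℕ.*-identityʳ (length xs))
      -- The singletons of the distinct elements are disjoint, and each meets `ys`.
      (packing _≡_ xs ys (AllPairs.map (λ { x≢y refl refl → x≢y refl }) uniq)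
        λ x∈ → count-some (xs⊆ys x∈) refl)

    finite-subset : (P : Pred A p) → ∀ xs → (∀ {x} → P x → x ∈ₗ xs) →
      ∃ λ n → HasFiniteSize P n × n ≤ count P xs
    finite-subset P xs P⊆xs = length zs , (zs , deduplicate-! _≟_ _ , mem , refl) ,
        length-deduplicate _≟_ (filter (decide P) xs)
      where
      zs = deduplicate _≟_ (filter (decide P) xs)
      mem : ∀ x → P x ⇔ (x ∈ₗ zs)
      mem x = mk⇔
        (λ Px → ∈-deduplicate⁺ _≟_ (∈-filter⁺ (decide P) (P⊆xs Px) Px))
        (λ x∈ → proj₂ (∈-filter⁻ (decide P) {xs = xs} (∈-deduplicate⁻ _≟_ (filter (decide P) xs) x∈)))

    -- Greedy choice: an element is left out only if a chosen one is already near it, so the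
    -- separated list also covers.
    maximal-packing : (R : Rel A ℓ) → (∀ {x} → R x x) → ∀ xs → ∃ λ ys →
      (∀ {y} → y ∈ₗ ys → y ∈ₗ xs) × AllPairs (λ x y → ¬ R y x) ys ×
      (∀ {x} → x ∈ₗ xs → ∃ λ y → y ∈ₗ ys × R y x)
    maximal-packing R R-refl [] = [] , (λ ()) , [] , λ ()
    maximal-packing R R-refl (x ∷ xs) with maximal-packing R R-refl xs
    ... | ys , ys⊆xs , sep , cover with lem {P = ∃ λ y → y ∈ₗ ys × R y x}
    ... | yes near = ys , there ∘ ys⊆xs , sep ,
          λ { (here refl) → near ; (there x∈) → cover x∈ }
    ... | no far = x ∷ ys , (λ { (here refl) → here refl ; (there y∈) → there (ys⊆xs y∈) }) ,
          All.tabulate (λ y∈ Ryx → far (_ , y∈ , Ryx)) ∷ sep ,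
          λ { (here refl) → x , here refl , R-refl
            ; (there z∈) → let y , y∈ , Ryz = cover z∈ in y , there y∈ , Ryz }

-- Balls and connectivity.

data Ball {A : Set a} (E : Rel A ℓ) : ℕ → A → A → Set (a Level.⊔ ℓ) where
  centre : ∀ {n v} → Ball E n v v
  _∷ʳ_   : ∀ {n v x y} → Ball E n v x → E x y → Ball E (suc n) v y

module _ {A : Set a} {E : Rel A ℓ} where

  Ball-mono : ∀ {m n v x} → m ≤ n → Ball E m v x → Ball E n v x
  Ball-mono _         centre    = centre
  Ball-mono (s≤s m≤n) (b ∷ʳ e) = Ball-mono m≤n b ∷ʳ e

  Ball-map : ∀ {F : Rel A q} → (∀ {x y} → E x y → F x y) →
    ∀ {n v x} → Ball E n v x → Ball F n v x
  Ball-map f centre   = centre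
  Ball-map f (b ∷ʳ e) = Ball-map f b ∷ʳ f e

  Ball-trans : ∀ {m n u v w} → Ball E m u v → Ball E n v w → Ball E (n + m) u w
  Ball-trans {n = n} b centre    = Ball-mono (ℕ.m≤n+m _ n) b
  Ball-trans         b (c ∷ʳ e) = Ball-trans b c ∷ʳ e

  Ball-sym : Symmetric E → ∀ {n u v} → Ball E n u v → Ball E n v u
  Ball-sym E-sym centre   = centre
  Ball-sym E-sym {suc n} {u} {v} (b ∷ʳ e) =
    subst (λ m → Ball E m v u) (ℕ.+-comm n 1)
      (Ball-trans (centre {n = 0} ∷ʳ E-sym e) (Ball-sym E-sym b))

  Joined : Rel A _
  Joined u v = ∃ λ n → Ball E n u v

  joined-refl : ∀ {u} → Joined u u
  joined-refl = 0 , centre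

  joined-trans : ∀ {u v w} → Joined u v → Joined v w → Joined u w
  joined-trans (_ , b) (_ , c) = _ , Ball-trans b c

  joined-sym : Symmetric E → Symmetric Joined
  joined-sym E-sym (_ , b) = _ , Ball-sym E-sym b

  joined-bound : ∀ {v} xs → (∀ {x} → x ∈ₗ xs → Joined v x) →
    ∃ λ n → ∀ {x} → x ∈ₗ xs → Ball E n v x
  joined-bound [] _ = 0 , λ ()
  joined-bound (x ∷ xs) joined with joined (here refl) | joined-bound xs (joined ∘ there)
  ... | m , b | n , bs = m + n ,
    λ { (here refl) → Ball-mono (ℕ.m≤m+n m n) b ; (there x∈) → Ball-mono (ℕ.m≤n+m n m) (bs x∈) }

-- Separators in graphs of linear growth.

LinearGrowth : {A : Set a} → Rel A ℓ → ℕ → Set _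
LinearGrowth E C = ∀ r v → .{{NonZero r}} →
  ∃ λ xs → (∀ {x} → Ball E r v x → x ∈ₗ xs) × length xs ≤ C * r

-- The largest boundary that a part of the decomposition is allowed to have.
capacity : ℕ → ℕ
capacity C = suc (5 * C * (2 * C) + 2 * C)

module Separators (lem : ∀ {a} → ExcludedMiddle a) where
  open Classical lem

  module _ {A : Set a} (E : Rel A ℓ) where

    Layer : ℕ → A → A → Set _
    Layer n v x = IsLeast (λ m → Ball E m v x) n

    layer-unique : ∀ {m n v x} → Layer m v x → Layer n v x → m ≡ n
    layer-unique (b , min) (b′ , min′) = ℕ.≤-antisym (min _ b′) (min′ _ b)

    outside⇒layer : ∀ {n v x} → Ball E (suc n) v x → ¬ Ball E n v x → Layer (suc n) v x
    outside⇒layer b ¬b = b , λ m c → ℕ.≰⇒> λ m≤n → ¬b (Ball-mono m≤n c)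

    -- A path leaving the ball of radius `n` must cross the next layer, so a ball that stops growing
    -- once is a whole component.
    empty-layer : ∀ {n v} → (∀ {x} → ¬ Layer (suc n) v x) → ∀ {m x} → Ball E m v x → Ball E n v x
    empty-layer empty centre = centre
    empty-layer empty (b ∷ʳ e) =
      stable λ ¬b → empty (outside⇒layer (empty-layer empty b ∷ʳ e) ¬b)

    layers-disjoint : ∀ {J : Set} (f : J → ℕ) → (∀ {i j} → f i ≡ f j → i ≡ j) → ∀ {v js} → Unique js →
      AllPairs (λ i j → ∀ {x} → Layer (f i) v x → ¬ Layer (f j) v x) js
    layers-disjoint f f-inj = AllPairs.map λ i≢j {x} l l′ → i≢j (f-inj (layer-unique l l′))

    -- The `suc g` layers at distances 0 to `g` are disjoint, and each contributes a vertex.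
    ball-large : ∀ g v xs → (∀ {x} → Ball E g v x → x ∈ₗ xs) →
      (∀ {i} → i ≤ g → ∃ λ x → Layer i v x) → suc g ≤ count (Ball E g v) xs
    ball-large g v xs ball⊆xs layers = subst (_≤ count (Ball E g v) xs)
      (trans (ℕ.*-identityʳ _) (length-upTo (suc g)))
      (packing (λ i → Layer i v) (upTo (suc g)) (filter (decide (Ball E g v)) xs)
        (layers-disjoint id id (Unique.upTo⁺ (suc g)))
        λ i∈ → let i≤g = ℕ.≤-pred (∈-upTo⁻ i∈)
                   x , l = layers i≤g
                   b = Ball-mono i≤g (proj₁ l)
               in count-some (∈-filter⁺ (decide (Ball E g v)) (ball⊆xs b) b) l)

    -- Averaging: the `2 * h` layers are disjoint subsets of a ball with at most `4 * C * h`
    -- vertices, so they cannot all have more than `2 * C`.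
    thin-layer : ∀ {C} → LinearGrowth E C → ∀ h v → .{{NonZero h}} →
      ∃ λ i → i < h + h × ∃ λ n →
        HasFiniteSize (Layer (suc (h + h + i)) v) n × n ≤ 2 * C
    thin-layer {C} growth h v = result
      where
      r = h + h + (h + h)
      instance r≢0 : NonZero r
      r≢0 = ℕ.>-nonZero (ℕ.≤-trans (ℕ.>-nonZero⁻¹ h)
              (ℕ.≤-trans (ℕ.m≤m+n h h) (ℕ.m≤m+n (h + h) (h + h))))
      ball = growth r v
      xs = proj₁ ball
      Shell : ℕ → A → Set _
      Shell i = Layer (suc (h + h + i)) v
      Thin : ℕ → Set
      Thin i = i < h + h × count (Shell i) xs ≤ 2 * C
      thick : ¬ ¬ ∃ Thin
      thick none = ℕ.<⇒≱ (ℕ.<-≤-trans large (packing Shell (upTo (h + h)) xs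
          (layers-disjoint (λ i → suc (h + h + i)) (ℕ.+-cancelˡ-≡ (h + h) _ _ ∘ ℕ.suc-injective)
            (Unique.upTo⁺ (h + h)))
          λ i∈ → ℕ.≰⇒> λ le → none (_ , ∈-upTo⁻ i∈ , le)))
          (proj₂ (proj₂ ball))
        where
        open ℕ.≤-Reasoning
        eq : ∀ C h → C * (h + h + (h + h)) ≡ (h + h) * (2 * C)
        eq = solve-∀
        large : C * r < length (upTo (h + h)) * suc (2 * C)
        large = begin-strict
          C * r ≡⟨ eq C h ⟩
          (h + h) * (2 * C) <⟨ ℕ.*-monoʳ-< (h + h)
            {{ℕ.>-nonZero (ℕ.≤-trans (ℕ.>-nonZero⁻¹ h) (ℕ.m≤m+n h h))}} (ℕ.n<1+n (2 * C)) ⟩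
          (h + h) * suc (2 * C) ≡⟨ cong (_* suc (2 * C)) (length-upTo (h + h)) ⟨
          length (upTo (h + h)) * suc (2 * C) ∎
      result : ∃ λ i → i < h + h × ∃ λ n → HasFiniteSize (Shell i) n × n ≤ 2 * C
      result with lem {P = ∃ Thin}
      ... | no none = contradiction none thick
      ... | yes (i , i< , thin) with finite-subset (Shell i) xs
            (λ l → proj₁ (proj₂ ball) (Ball-mono (ℕ.+-monoʳ-< (h + h) i<) (proj₁ l)))
      ... | n , size , n≤ = i , i< , n , size , ℕ.≤-trans n≤ thin

    -- The side of `I` gets the boundary `W ∩ I` together with `S`, the other side gets the rest of
    -- `W` together with `S`. `I-small` and `S-small` make these two boundaries smaller than `W`.
    -- Joinedness to a vertex of `W` keeps `I` and `S` inside the part that is being split.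
    record Separator (C : ℕ) (W : List A) : Set (Level.suc (a Level.⊔ ℓ)) where
      field
        I       : Pred A (a Level.⊔ ℓ)
        S       : List A
        S-uniq  : Unique S
        origin  : A
        origin∈ : origin ∈ₗ W
        I-joined : ∀ {x} → I x → Joined {E = E} origin x
        S-joined : ∀ {x} → x ∈ₗ S → Joined {E = E} origin x
        I∩S     : ∀ {x} → I x → x ∉ₗ S
        closed  : ∀ {x y} → I x → E x y → I y ⊎ y ∈ₗ S
        S≤      : length S ≤ 2 * C
        S-small : length S < count I W
        I-small : count I W + length S < length W

    module _ (E-sym : Symmetric E) {C} (growth : LinearGrowth E C) .{{_ : NonZero C}}
             {W : List A} (W-uniq : Unique W) (W-size : capacity C ≤ length W) where

      private
        Heavy : ℕ → A → Set
        Heavy h v = 2 * C < count (Ball E (h + h) v) W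

        2C<W : 2 * C < length W
        2C<W = ℕ.≤-trans (s≤s (ℕ.m≤n+m (2 * C) (5 * C * (2 * C)))) W-size

        -- A ball of radius 0 is a single vertex, `W` has no repetitions, and `2 * C` is at least 1.
        ¬heavy₀ : ∀ {v} → ¬ Heavy 0 v
        ¬heavy₀ {v} heavy = ℕ.<⇒≱ (ℕ.<-≤-trans heavy
            (unique-length (Unique.filter⁺ (decide (Ball E 0 v)) W-uniq) ⊆v))
          (ℕ.≤-trans (ℕ.>-nonZero⁻¹ C) (ℕ.m≤m+n C (C + 0)))
          where
          ⊆v : ∀ {x} → x ∈ₗ filter (decide (Ball E 0 v)) W → x ∈ₗ (v ∷ [])
          ⊆v x∈ with ∈-filter⁻ (decide (Ball E 0 v)) {xs = W} x∈
          ... | _ , centre = here refl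

      module _ (joined : ∀ {x y} → x ∈ₗ W → y ∈ₗ W → Joined {E = E} x y) where

        private
          -- Greedily chosen points of W near v carry disjoint g-balls inside a
          -- (5g + 5)-ball, so there are at most 5C of them; by minimality of
          -- g + 1 each 2g-ball meets W in at most 2C vertices.
          few-near : ∀ g v → (∀ {y} → y ∈ₗ W → ¬ Heavy g y) → ∀ n → n ≤ 4 * suc g →
            count (Ball E n v) W ≤ 5 * C * (2 * C)
          few-near g v light n n≤ = let
              near = filter (decide (Ball E n v)) W
              Close = λ x y → Ball E (g + g) x y
              ys , ys⊆ , sep , cover = maximal-packing Close centre near
              xs , ball⊆ , xs≤ = growth (5 * suc g) v
              W∋ = λ {y} (y∈ : y ∈ₗ ys) → proj₁ (∈-filter⁻ (decide (Ball E n v)) {xs = W} (ys⊆ y∈))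
              in⊆ = λ {y} (y∈ : y ∈ₗ ys) {x} (b : Ball E g y x) → ball⊆ {x} (Ball-mono (radius g n n≤)
                      (Ball-trans (proj₂ (∈-filter⁻ (decide (Ball E n v)) {xs = W} (ys⊆ y∈))) b))
              bound = packing (λ y → Ball E g y) ys xs
                -- A common vertex of two `g`-balls would bring their centres within distance
                -- `g + g`.
                (AllPairs.map (λ ¬close {x} b b′ → ¬close (Ball-trans b′ (Ball-sym E-sym b))) sep)
                λ {y} y∈ → ball-large g y xs (in⊆ y∈) (layer g (W∋ y∈) (light (W∋ y∈)))
            in ℕ.≤-trans
              (covering Close ys near cover
                (λ y∈ → ℕ.≤-trans (count-filter (Close _) _ W) (ℕ.≮⇒≥ (light (W∋ y∈)))))
              (ℕ.*-monoˡ-≤ (2 * C) (ℕ.*-cancelʳ-≤ (length ys) (5 * C) (suc g)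
                (ℕ.≤-trans bound (ℕ.≤-trans xs≤ (ℕ.≤-reflexive (eq C (suc g)))))))
            where
            eq : ∀ C h → C * (5 * h) ≡ 5 * C * h
            eq = solve-∀
            radius : ∀ g n → n ≤ 4 * suc g → g + n ≤ 5 * suc g
            radius g n n≤ = ℕ.+-mono-≤ (ℕ.n≤1+n g) n≤
            -- If a layer up to distance `g` were empty, the whole component of `y`, and with it
            -- `W`, would lie within distance `g` of `y`, which would make `y` heavy.
            layer : ∀ g {y} → y ∈ₗ W → ¬ Heavy g y → ∀ {i} → i ≤ g → ∃ λ x → Layer i y x
            layer g {y} y∈ light {zero} _ = y , centre , λ _ _ → z≤n
            layer g {y} y∈ light {suc i} i<g with lem {P = ∃ λ x → Layer (suc i) y x}
            ... | yes l = l
            ... | no none = contradiction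
              (subst (2 * C <_) (sym (count-all all-near)) 2C<W) light
              where
              all-near : ∀ {w} → w ∈ₗ W → Ball E (g + g) y w
              all-near w∈ = Ball-mono (ℕ.≤-trans (ℕ.<⇒≤ i<g) (ℕ.m≤m+n g g))
                (empty-layer (λ l → none (_ , l)) (proj₂ (joined y∈ w∈)))

        ball-separator : ∀ {w} → w ∈ₗ W → Separator C W
        ball-separator {w} w∈ with joined-bound W (joined w∈)
        -- A ball around `w` of radius `N` already contains all of `W`, so some heavy radius exists.
        ... | N , ball with least (λ h → ∃ λ v → v ∈ₗ W × Heavy h v)
              (N , w , w∈ , subst (2 * C <_)
                (sym (count-all λ x∈ → Ball-mono (ℕ.m≤m+n N N) (ball x∈))) 2C<W)
        ... | zero , (v , v∈ , heavy) , _ = contradiction heavy ¬heavy₀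
        ... | suc g , (v , v∈ , heavy) , min with thin-layer {C} growth (suc g) v
        ... | i , i<2h , _ , (S , S-uniq , S⇔ , refl) , S≤ = record
          { I = Ball E m v
          ; S = S
          ; S-uniq = S-uniq
          ; origin = v
          ; origin∈ = v∈
          ; I-joined = λ b → _ , b
          ; S-joined = λ x∈ → _ , proj₁ (layer x∈)
          ; I∩S = λ b x∈ → ℕ.1+n≰n (proj₂ (layer x∈) m b)
          ; closed = λ b e → inside-or-layer (b ∷ʳ e)
          ; S≤ = S≤
          -- `I` contains the heavy ball around `v`, which has more than `2 * C` vertices of `W`.
          ; S-small = ℕ.≤-<-trans S≤ (ℕ.≤-trans heavy
              (count-mono (Ball-mono (ℕ.m≤m+n (suc g + suc g) i)) W))
          -- The value of `capacity` comes from here: it exceeds by one the bound for `I` within `W`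
          -- plus the bound for `S`.
          ; I-small = ℕ.≤-trans (s≤s (ℕ.+-mono-≤ I≤ S≤)) W-size
          }
          where
          m = suc g + suc g + i
          layer : ∀ {x} → x ∈ₗ S → Layer (suc m) v x
          layer x∈ = Equivalence.from (S⇔ _) x∈
          inside-or-layer : ∀ {y} → Ball E (suc m) v y → Ball E m v y ⊎ y ∈ₗ S
          inside-or-layer {y} b with lem {P = Ball E m v y}
          ... | yes b′ = inj₁ b′
          ... | no ¬b′ = inj₂ (Equivalence.to (S⇔ y) (outside⇒layer b ¬b′))
          radius : ∀ h → h + h + (h + h) ≡ 4 * h
          radius = solve-∀
          I≤ : count (Ball E m v) W ≤ 5 * C * (2 * C)
          I≤ = few-near g v (λ y∈ heavy′ → ℕ.1+n≰n (min g (_ , y∈ , heavy′))) m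
            (ℕ.≤-trans (ℕ.+-monoʳ-≤ (suc g + suc g) (ℕ.<⇒≤ i<2h)) (ℕ.≤-reflexive (radius (suc g))))

      separator : Separator C W
      separator with nonempty W (ℕ.≤-trans (s≤s z≤n) W-size)
        where
        nonempty : ∀ xs → 0 < length xs → ∃ λ w → w ∈ₗ xs
        nonempty (x ∷ _) _ = x , here refl
      ... | w , w∈ with lem {P = ∀ {x} → x ∈ₗ W → Joined {E = E} w x}
      ... | yes joined = ball-separator
            (λ x∈ y∈ → joined-trans (joined-sym E-sym (joined x∈)) (joined y∈)) w∈
      ... | no ¬joined = record
        { I = Joined {E = E} w
        ; S = []
        ; S-uniq = []
        ; origin = w
        ; origin∈ = w∈
        ; I-joined = id
        ; S-joined = λ ()
        ; I∩S = λ _ ()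
        ; closed = λ { (n , b) e → inj₁ (suc n , b ∷ʳ e) }
        ; S≤ = z≤n
        ; S-small = count-some w∈ joined-refl
        ; I-small = subst (_< length W) (sym (ℕ.+-identityʳ _)) (ℕ.≰⇒> λ W≤ →
            ¬joined λ {x} x∈ → stable λ ¬j → ℕ.<⇒≱ (count-strict _ x∈ tt ¬j)
              (subst (_≤ count (Joined {E = E} w) W) (sym (count-all {P = λ _ → ⊤} {W} _)) W≤))
        }

-- Walks, cycles and the tree of finite sequences.

ball⇒walk : {A : Set a} {E : Rel A ℓ} → ∀ {n u v} → Ball E n u v →
  ∃ λ m → m ≤ n × Walk E m u v
ball⇒walk centre = 0 , z≤n , []
ball⇒walk {E = E} (b ∷ʳ e) with ball⇒walk b
... | m , m≤n , w = suc m , s≤s m≤n , snoc w e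
  where
  snoc : ∀ {m u v x} → Walk E m u v → E v x → Walk E (suc m) u x
  snoc []       e = e ∷ []
  snoc (d ∷ w) e = d ∷ snoc w e

argmax : ∀ {n} (g : Fin (suc n) → ℕ) → ∃ λ m → ∀ i → g i ≤ g m
argmax {zero}  g = zero , λ { zero → ℕ.≤-refl }
argmax {suc n} g with argmax (g ∘ suc)
... | m , max with ℕ.≤-total (g (suc m)) (g zero)
... | inj₁ le = zero , λ { zero → ℕ.≤-refl ; (suc i) → ℕ.≤-trans (max i) le }
... | inj₂ ge = suc m , λ { zero → ge ; (suc i) → max i }

-- The neighbours are the successor and the predecessor along the cycle; at the two ends of the
-- enumeration one of them lies across the closing edge. They differ because a cycle has at least
-- three vertices.
cycle-neighbours : ∀ {k} {A : Set a} (E : Rel A ℓ) → Symmetric E → (f : Fin (3 + k) → A) →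
  (∀ i → E (f (inject₁ i)) (f (suc i))) → E (f (fromℕ (2 + k))) (f zero) →
  ∀ i → ∃ λ j → ∃ λ l → j ≢ l × E (f i) (f j) × E (f i) (f l)
cycle-neighbours {k = k} E E-sym f next close zero =
  suc zero , fromℕ (2 + k) , (λ ()) , next zero , E-sym close
cycle-neighbours E E-sym f next close (suc i) with view i
... | ‵fromℕ     = inject₁ i , zero , (λ ()) , E-sym (next i) , close
... | ‵inject₁ j = inject₁ i , suc (suc j) , distinct , E-sym (next i) , next (suc j)
  where
  distinct : inject₁ (inject₁ j) ≢ suc (suc j)
  distinct eq = ℕ.m≢1+n+m (toℕ j) {1} (trans
    (sym (trans (Fin.toℕ-inject₁ (inject₁ j)) (Fin.toℕ-inject₁ j))) (cong toℕ eq))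

-- A node is the sequence of choices leading to it from the root, the last
-- choice coming first.
module PathTree (I : Set ℓ) where

  _↑_ : Rel (List I) ℓ
  xs ↑ ys = ∃ λ i → xs ≡ i ∷ ys

  ↑-irr : ∀ {xs} → ¬ (xs ↑ xs)
  ↑-irr {xs} (i , eq) = ℕ.m≢1+n+m (length xs) {0} (cong length eq)

  tree : Graph ℓ
  tree = record
    { Vertex = List I
    ; _~_    = λ xs ys → xs ↑ ys ⊎ ys ↑ xs
    ; ~-sym  = λ { (inj₁ e) → inj₂ e ; (inj₂ e) → inj₁ e }
    ; ~-irr  = λ { refl (inj₁ e) → ↑-irr e ; refl (inj₂ e) → ↑-irr e }
    }

  -- Climbing from parent to parent within `P` can only stop at `t`, which connects every node of
  -- `P` to `t`.
  isTree : ∀ {P : Pred (List I) ℓ} t → P t →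
    (∀ xs → P xs → xs ≡ t ⊎ ∃ λ ys → xs ↑ ys × P ys) → IsTree (induced tree P)
  isTree {P} t Pt top = (t , Pt) , connected , acyclic
    where
    open Subgraph (induced tree P) using (E; E-sym)

    joined : ∀ xs → P xs → Joined {E = E} t xs
    joined xs Pxs with top xs Pxs
    joined xs Pxs | inj₁ refl = joined-refl
    joined (i ∷ ys) Pxs | inj₂ (_ , (_ , refl) , Pys) with joined ys Pys
    ... | n , b = suc n , b ∷ʳ (Pys , Pxs , inj₂ (i , refl))

    connected : Connected (induced tree P)
    connected xs ys Pxs Pys =
      let n , b = joined-trans (joined-sym E-sym (joined xs Pxs)) (joined ys Pys)
          m , _ , w = ball⇒walk b
      in m , w

    -- Both neighbours of a deepest node of a cycle would be its parent.
    acyclic : ¬ Cycle (induced tree P)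
    acyclic (k , f , f-inj , next , close) with argmax (length ∘ f)
    ... | m , max with cycle-neighbours E E-sym f next close m
    ... | j , l , j≢l , ej , el = j≢l (f-inj
        (∷-injectiveʳ (trans (sym (proj₂ (parent j ej))) (proj₂ (parent l el)))))
      where
      parent : ∀ i → E (f m) (f i) → f m ↑ f i
      parent i (_ , _ , inj₁ up) = up
      parent i (_ , _ , inj₂ (x , eq)) = contradiction (max i)
        (ℕ.<⇒≱ (ℕ.≤-reflexive (sym (cong length eq))))

-- Tree-decompositions from recursive splitting.

record Scheme (G : Graph ℓ) (I : Set ℓ) q : Set (Level.suc (ℓ Level.⊔ q)) where
  open Graph G using (_~_)
  field
    State     : Set q
    start     : State
    child     : State → I → State
    Part Bag  : State → Pred (Vertex G) ℓ
    bag⊆      : ∀ s {v} → Bag s v → Part s v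
    child⊆    : ∀ s i {v} → Part (child s i) v → Part s v
    child-bag : ∀ s i {v} → Part (child s i) v → Bag s v → Bag (child s i) v
    disjoint  : ∀ s {i j v} → i ≢ j → Part (child s i) v → Part (child s j) v → Bag s v

  state : List I → State
  state []       = start
  state (i ∷ xs) = child (state xs) i

  -- The case `u ≡ v` is included so that isolated vertices lie in a bag too.
  Captures : Set ℓ
  Captures = ∀ {u v} → u ≡ v ⊎ u ~ v → ∃ λ xs → Bag (state xs) u × Bag (state xs) v

module SchemeTree (lem : ∀ {a} → ExcludedMiddle a) {G : Graph ℓ} {I : Set ℓ}
                  (scheme : Scheme G I q) where
  open Scheme scheme
  open PathTree I

  module _ (v : Vertex G) where

    -- The descent of `v` from the root: it follows parts containing `v` as long as no bag has
    -- caught it.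
    Fresh : List I → Set ℓ
    Fresh []       = Poly.⊤
    Fresh (i ∷ xs) = Fresh xs × ¬ Bag (state xs) v × Part (state (i ∷ xs)) v

    -- By `child-bag`, a vertex caught by a bag stays in the bags below while it is in their parts;
    -- so missing the bag at `xs` means missing every bag above.
    fresh : ∀ {i} xs → Part (state (i ∷ xs)) v → ¬ Bag (state xs) v → Fresh (i ∷ xs)
    fresh []           part ¬bag = _ , ¬bag , part
    fresh {i} (j ∷ xs) part ¬bag = fresh xs part′ (¬bag ∘ child-bag _ j part′) , ¬bag , part
      where
      part′ : Part (state (j ∷ xs)) v
      part′ = child⊆ _ i part

    -- The descent never branches: by `disjoint`, two children sharing `v` would have `v` in the bag
    -- of their parent.
    fresh-unique : ∀ xs ys → length xs ≡ length ys → Fresh xs → Fresh ys → xs ≡ ys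
    fresh-unique [] [] _ _ _ = refl
    fresh-unique (i ∷ xs) (j ∷ ys) eq (fx , ¬bag , part) (fy , _ , part′)
      with fresh-unique xs ys (ℕ.suc-injective eq) fx fy
    ... | refl with lem {P = i ≡ j}
    ... | yes refl = refl
    ... | no i≢j = contradiction (disjoint _ i≢j part part′) ¬bag

    -- The descent to `ys` passes through the only fresh node of the length of `xs`, and goes on
    -- only if the bag there misses `v`.
    fresh-above : ∀ xs ys → length xs < length ys → Fresh xs → Fresh ys → ¬ Bag (state xs) v
    fresh-above xs (j ∷ ys) lt fx (fy , ¬bag , _) with ℕ.m≤n⇒m<n∨m≡n (ℕ.≤-pred lt)
    ... | inj₁ lt′ = fresh-above xs ys lt′ fx fy
    ... | inj₂ eq with fresh-unique xs ys eq fx fy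
    ... | refl = ¬bag

    Top : List I → Set ℓ
    Top xs = Fresh xs × Bag (state xs) v

    top-unique : ∀ {xs ys} → Top xs → Top ys → xs ≡ ys
    top-unique {xs} {ys} (fx , bx) (fy , by) = fresh-unique xs ys
      (ℕ.≤-antisym (ℕ.≮⇒≥ λ lt → fresh-above ys xs lt fy fx by)
                   (ℕ.≮⇒≥ λ lt → fresh-above xs ys lt fx fy bx)) fx fy

    top-or-parent : ∀ xs → Bag (state xs) v → Top xs ⊎ ∃ λ ys → xs ↑ ys × Bag (state ys) v
    top-or-parent []       bag = inj₁ (_ , bag)
    top-or-parent (i ∷ xs) bag with lem {P = Bag (state xs) v}
    ... | yes bag′ = inj₂ (xs , (i , refl) , bag′)
    ... | no ¬bag′ = inj₁ (fresh xs (bag⊆ _ bag) ¬bag′ , bag)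

    top : ∀ xs → Bag (state xs) v → ∃ Top
    top xs bag with top-or-parent xs bag
    top xs bag       | inj₁ t = xs , t
    top (i ∷ xs) bag | inj₂ (_ , (_ , refl) , bag′) = top xs bag′

    bags-tree : ∀ xs → Bag (state xs) v → IsTree (induced tree (λ ys → Bag (state ys) v))
    bags-tree xs bag with top xs bag
    ... | t , t-top = isTree t (proj₂ t-top) λ ys →
      Sum.map₁ (λ y-top → top-unique y-top t-top) ∘ top-or-parent ys

  decomposition : Captures → TreeDecomposition G
  decomposition captures = record
    { T        = tree
    ; T-tree   = isTree [] _ λ { [] _ → inj₁ refl ; (i ∷ xs) _ → inj₂ (xs , (i , refl) , _) }
    ; bag      = λ xs → Bag (state xs)
    ; edges    = captures ∘ inj₂
    ; subtrees = λ v → let xs , bag , _ = captures (inj₁ (refl {x = v})) in bags-tree v xs bag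
    }

-- The decomposition of a graph of linear growth.

module Decompose (lem : ∀ {a} → ExcludedMiddle a) (ext : ∀ {a b} → Extensionality a b)
                 (G : Graph ℓ) {C} .{{_ : NonZero C}} (growth : LinearGrowth (Graph._~_ G) C) where
  open Graph G using (_~_; ~-sym)
  open Classical lem
  open Separators lem

  private
    V = Vertex G
    cap = capacity C

    -- The witness is taken from `lem` and not from the argument, so the chosen vertex depends on
    -- `P` alone.
    pick : (P : V → Bool) → ∃ (λ x → P x ≡ true) → V
    pick P inhabited with lem {P = ∃ λ x → P x ≡ true}
    ... | yes (x , _) = x
    ... | no none = contradiction inhabited none

    pick-cong : ∀ {P Q : V → Bool} i j → P ≡ Q → pick P i ≡ pick Q j
    pick-cong {P} i j refl with lem {P = ∃ λ x → P x ≡ true}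
    ... | yes _ = refl
    ... | no none = contradiction i none

    pick-satisfies : ∀ (P : V → Bool) (i : ∃ λ x → P x ≡ true) → P (pick P i) ≡ true
    pick-satisfies P i with lem {P = ∃ λ x → P x ≡ true}
    ... | yes (_ , Px) = Px
    ... | no none = contradiction i none

    -- Boolean values let function extensionality alone identify the components of joined vertices.
    component : V → V → Bool
    component v x = does (lem {P = Joined {E = _~_} v x})

    component-sound : ∀ {v x} → component v x ≡ true → Joined {E = _~_} v x
    component-sound {v} {x} eq with lem {P = Joined {E = _~_} v x}
    ... | yes j = j
    component-sound () | no _

    component-complete : ∀ {v x} → Joined {E = _~_} v x → component v x ≡ true
    component-complete {v} {x} j with lem {P = Joined {E = _~_} v x}
    ... | yes _ = refl
    ... | no ¬j = contradiction j ¬j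

    component-inhabited : ∀ v → ∃ λ x → component v x ≡ true
    component-inhabited v = v , component-complete joined-refl

  -- Joined vertices have the same component as a Boolean function, hence the
  -- same representative.
  rep : V → V
  rep v = pick (component v) (component-inhabited v)

  rep-joined : ∀ v → Joined {E = _~_} (rep v) v
  rep-joined v = joined-sym ~-sym (component-sound (pick-satisfies (component v) (component-inhabited v)))

  rep-cong : ∀ {u v} → Joined {E = _~_} u v → rep u ≡ rep v
  rep-cong {u} {v} j = pick-cong (component-inhabited u) (component-inhabited v) (ext λ x → does-⇔
    (mk⇔ (joined-trans (joined-sym ~-sym j)) (joined-trans j)) lem lem)

  -- `U` is a part still to be decomposed and `W` its boundary. `root` confines `U` to one component
  -- of `G`, so that distances to a single representative are available for all its vertices.
  record Piece : Set (Level.suc ℓ) where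
    field
      U      : Pred V ℓ
      W      : List V
      W⊆U    : ∀ {x} → x ∈ₗ W → U x
      W-uniq : Unique W
      W≤     : length W ≤ cap
      root   : ∀ {x y} → U x → U y → rep x ≡ rep y

    Fresh : Pred V ℓ
    Fresh x = U x × x ∉ₗ W

    -- Padding the boundary by a vertex of xs lowers the number of fresh
    -- vertices in xs, which therefore weighs double; separating lowers the
    -- size of the boundary and creates no fresh vertex.
    measure : List V → ℕ
    measure xs = count Fresh xs + count Fresh xs + length W

  open Piece

  -- A node of the decomposition with the two parts below it. As `U` may be infinite, `progress`
  -- measures only within a list `xs` that contains a ball around the representative holding a fresh
  -- vertex.
  record Step (s : Piece) : Set (Level.suc ℓ) where
    field
      bag      : List V
      bag≤     : length bag ≤ cap + 2 * C
      W⊆bag    : ∀ {x} → x ∈ₗ W s → x ∈ₗ bag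
      bag⊆U    : ∀ {x} → x ∈ₗ bag → U s x
      next     : Bool → Piece
      next⊆    : ∀ b {x} → U (next b) x → U s x
      next-bag : ∀ b {x} → U (next b) x → x ∈ₗ bag → x ∈ₗ W (next b)
      disjoint : ∀ {x} → U (next true) x → U (next false) x → x ∈ₗ bag
      cover    : ∀ {x y} → U s x → U s y → x ≡ y ⊎ x ~ y →
        (x ∈ₗ bag × y ∈ₗ bag) ⊎ ∃ λ b → U (next b) x × U (next b) y
      progress : ∀ {n x xs} → (∀ {y} → Ball _~_ n (rep x) y → y ∈ₗ xs) →
        Ball _~_ n (rep x) x → Fresh s x → ∀ b → measure (next b) xs < measure s xs

  -- Fills the places of missing children, so that all nodes have the same set of choices.
  empty : Piece
  empty = record
    { U = λ _ → Empty.⊥; W = []; W⊆U = λ (); W-uniq = []; W≤ = z≤n; root = λ () }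

  private
    W≤bag : ∀ {n} → n ≤ cap → n ≤ cap + 2 * C
    W≤bag n≤ = ℕ.≤-trans n≤ (ℕ.m≤m+n cap (2 * C))

  finish : (s : Piece) → ¬ ∃ (Fresh s) → Step s
  finish s none = record
    { bag      = W s
    ; bag≤     = W≤bag (W≤ s)
    ; W⊆bag    = id
    ; bag⊆U    = W⊆U s
    ; next     = λ _ → empty
    ; next⊆    = λ _ ()
    ; next-bag = λ _ ()
    ; disjoint = λ ()
    ; cover    = λ x∈ y∈ _ → inj₁ (all x∈ , all y∈)
    ; progress = λ _ _ fresh _ → contradiction (_ , fresh) none
    }
    where
    all : ∀ {x} → U s x → x ∈ₗ W s
    all x∈ = stable λ x∉ → none (_ , x∈ , x∉)

  -- A fresh vertex nearest to the representative lies in every ball around the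
  -- representative that contains a fresh vertex.
  pad : (s : Piece) → length (W s) < cap → ∃ (Fresh s) → Step s
  pad s W< (x₀ , fresh₀) with least (λ n → ∃ λ x → Fresh s x × Ball _~_ n (rep x) x)
    (let n , b = rep-joined x₀ in n , x₀ , fresh₀ , b)
  ... | n , (x , fresh , ball) , min = record
    { bag      = W s
    ; bag≤     = W≤bag (W≤ s)
    ; W⊆bag    = id
    ; bag⊆U    = W⊆U s
    ; next     = next
    ; next⊆    = λ { true → id ; false () }
    ; next-bag = λ { true _ → there ; false () }
    ; disjoint = λ _ ()
    ; cover    = λ x∈ y∈ _ → inj₂ (true , x∈ , y∈)
    ; progress = progress
    }
    where
    padded : Piece
    padded = record
      { U      = U s
      ; W      = x ∷ W s
      ; W⊆U    = λ { (here refl) → proj₁ fresh ; (there y∈) → W⊆U s y∈ }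
      ; W-uniq = All.tabulate (λ { y∈ refl → proj₂ fresh y∈ }) ∷ W-uniq s
      ; W≤     = W<
      ; root   = root s
      }
    next : Bool → Piece
    next true  = padded
    next false = empty
    arith : ∀ {c d} w → c < d → c + c + suc w < d + d + w
    arith {c} {d} w c<d = subst (_≤ d + d + w) (eq c w)
      (ℕ.+-monoˡ-≤ w (ℕ.+-mono-≤ c<d c<d))
      where
      eq : ∀ c w → suc c + suc c + w ≡ suc (c + c + suc w)
      eq = solve-∀
    progress : ∀ {n y xs} → (∀ {z} → Ball _~_ n (rep y) z → z ∈ₗ xs) →
      Ball _~_ n (rep y) y → Fresh s y → ∀ b → measure (next b) xs < measure s xs
    progress {n′} {y} {xs} ball⊆ b fresh′ = λ
      { true  → arith (length (W s)) fewer
      ; false → ℕ.≤-<-trans (ℕ.+-mono-≤ (ℕ.+-mono-≤ none none) z≤n) (arith (length (W s)) fewer) }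
      where
      x∈xs : x ∈ₗ xs
      x∈xs = ball⊆ (subst (λ r → Ball _~_ n′ r x) (root s (proj₁ fresh) (proj₁ fresh′))
        (Ball-mono (min n′ (y , fresh′ , b)) ball))
      fewer : count (Fresh padded) xs < count (Fresh s) xs
      fewer = count-strict (λ (z∈ , z∉) → z∈ , z∉ ∘ there) x∈xs fresh (λ (_ , x∉) → x∉ (here refl))
      none : count (Fresh empty) xs ≤ count (Fresh padded) xs
      none = count-mono {P = Fresh empty} {Fresh padded} (λ ()) xs

  separate : (s : Piece) → cap ≤ length (W s) → Step s
  separate s W≥ = record
    { bag      = W s ++ S
    ; bag≤     = subst (_≤ cap + 2 * C) (sym (length-++ (W s))) (ℕ.+-mono-≤ (W≤ s) S≤)
    ; W⊆bag    = ∈-++⁺ˡ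
    ; bag⊆U    = λ x∈ → Sum.[ W⊆U s , S⊆U ]′ (∈-++⁻ (W s) x∈)
    ; next     = next
    ; next⊆    = λ { true → inside⊆ ; false → proj₁ }
    ; next-bag = next-bag
    ; disjoint = λ { (inj₁ i) (_ , ¬i) → contradiction i ¬i ; (inj₂ x∈) _ → ∈-++⁺ʳ (W s) x∈ }
    ; cover    = cover
    ; progress = λ {_} {_} {xs} _ _ _ b →
        ℕ.+-mono-≤-< (ℕ.+-mono-≤ (fresh≤ b xs) (fresh≤ b xs)) (smaller b)
    }
    where
    -- The separator is sought inside `U`: edges of `E` have both ends in `U`, so whatever is joined
    -- to the origin stays in `U`.
    E : Rel V ℓ
    E = Subgraph.E (induced G (U s))

    growth′ : LinearGrowth E C
    growth′ r v = let xs , ball⊆ , xs≤ = growth r v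
                  in xs , ball⊆ ∘ Ball-map (λ (_ , _ , e) → e) , xs≤

    open Separator (separator E (Subgraph.E-sym (induced G (U s))) {C} growth′ (W-uniq s) W≥)

    origin∈U : ∀ {x} → Joined {E = E} origin x → U s x
    origin∈U (_ , centre)            = W⊆U s origin∈
    origin∈U (_ , _ ∷ʳ (_ , x∈ , _)) = x∈

    I⊆U : ∀ {x} → I x → U s x
    I⊆U = origin∈U ∘ I-joined

    S⊆U : ∀ {x} → x ∈ₗ S → U s x
    S⊆U = origin∈U ∘ S-joined

    inside⊆ : ∀ {x} → I x ⊎ x ∈ₗ S → U s x
    inside⊆ = Sum.[ I⊆U , S⊆U ]′

    -- `Q` selects the old boundary vertices of the side `P` that avoid `S`, so that appending `S`
    -- creates no repetition.
    part : (P Q : Pred V ℓ) → (∀ {x} → P x → U s x) →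
      (∀ {x} → Q x → x ∈ₗ W s → P x) → (∀ {x} → x ∈ₗ S → P x) →
      (∀ {x} → Q x → x ∉ₗ S) → count Q (W s) + length S < length (W s) → Piece
    part P Q P⊆U Q⊆P S⊆P Q∩S small = record
      { U      = P
      ; W      = filter (decide Q) (W s) ++ S
      ; W⊆U    = λ x∈ → Sum.[ (λ x∈ → let x∈W , Qx = ∈-filter⁻ (decide Q) {xs = W s} x∈ in Q⊆P Qx x∈W)
                            , S⊆P ]′ (∈-++⁻ (filter (decide Q) (W s)) x∈)
      ; W-uniq = Unique.++⁺ (Unique.filter⁺ (decide Q) (W-uniq s)) S-uniq
                   λ (x∈ , x∈S) → Q∩S (proj₂ (∈-filter⁻ (decide Q) {xs = W s} x∈)) x∈S
      ; W≤     = subst (_≤ cap) (sym (length-++ (filter (decide Q) (W s))))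
                   (ℕ.≤-trans (ℕ.<⇒≤ small) (W≤ s))
      ; root   = λ x∈ y∈ → root s (P⊆U x∈) (P⊆U y∈)
      }

    Rest : Pred V ℓ
    Rest x = ¬ I x × x ∉ₗ S

    -- `S` replaces the boundary vertices in `I`, which outnumber it by `S-small`.
    rest-small : count Rest (W s) + length S < length (W s)
    rest-small = subst (count Rest (W s) + length S <_) (count-∁ I (W s))
      (subst (_< count I (W s) + count (λ x → ¬ I x) (W s)) (ℕ.+-comm (length S) _)
        (ℕ.+-mono-<-≤ S-small (count-mono proj₁ (W s))))

    S∩I : ∀ {x} → x ∈ₗ S → ¬ I x
    S∩I x∈ i = I∩S i x∈

    next : Bool → Piece
    next true  = part (λ x → I x ⊎ x ∈ₗ S) I inside⊆ (λ i _ → inj₁ i) inj₂ I∩S I-small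
    next false = part (λ x → U s x × ¬ I x) Rest proj₁ (λ (¬i , _) x∈ → W⊆U s x∈ , ¬i)
      (λ x∈ → S⊆U x∈ , S∩I x∈) proj₂ rest-small

    next-bag : ∀ b {x} → U (next b) x → x ∈ₗ W s ++ S → x ∈ₗ W (next b)
    next-bag true x∈ x∈bag with ∈-++⁻ (W s) x∈bag | x∈
    ... | _       | inj₂ x∈S = ∈-++⁺ʳ _ x∈S
    ... | inj₂ x∈S | _       = ∈-++⁺ʳ _ x∈S
    ... | inj₁ x∈W | inj₁ i  = ∈-++⁺ˡ (∈-filter⁺ (decide I) x∈W i)
    next-bag false {x} (_ , ¬i) x∈bag with lem {P = x ∈ₗ S} | ∈-++⁻ (W s) x∈bag
    ... | yes x∈S | _        = ∈-++⁺ʳ _ x∈S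
    ... | no _    | inj₂ x∈S = ∈-++⁺ʳ _ x∈S
    ... | no x∉S  | inj₁ x∈W = ∈-++⁺ˡ (∈-filter⁺ (decide Rest) x∈W (¬i , x∉S))

    next⊆ : ∀ b {x} → U (next b) x → U s x
    next⊆ true  = inside⊆
    next⊆ false = proj₁

    cover : ∀ {x y} → U s x → U s y → x ≡ y ⊎ x ~ y →
      (x ∈ₗ W s ++ S × y ∈ₗ W s ++ S) ⊎ ∃ λ b → U (next b) x × U (next b) y
    cover {x} {y} x∈ y∈ e with lem {P = I x} | lem {P = I y}
    ... | no ¬i | no ¬j = inj₂ (false , (x∈ , ¬i) , (y∈ , ¬j))
    ... | yes i | _     = inj₂ (true , inj₁ i , neighbour e)
      where
      neighbour : x ≡ y ⊎ x ~ y → I y ⊎ y ∈ₗ S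
      neighbour (inj₁ refl) = inj₁ i
      neighbour (inj₂ e)    = closed i (x∈ , y∈ , e)
    ... | no _  | yes j = inj₂ (true , neighbour e , inj₁ j)
      where
      neighbour : x ≡ y ⊎ x ~ y → I x ⊎ x ∈ₗ S
      neighbour (inj₁ refl) = inj₁ j
      neighbour (inj₂ e)    = closed j (y∈ , x∈ , ~-sym e)

    smaller : ∀ b → length (W (next b)) < length (W s)
    smaller true  = subst (_< length (W s)) (sym (length-++ (filter (decide I) (W s)))) I-small
    smaller false = subst (_< length (W s)) (sym (length-++ (filter (decide Rest) (W s)))) rest-small

    fresh≤ : ∀ b xs → count (Fresh (next b)) xs ≤ count (Fresh s) xs
    fresh≤ b = count-mono λ (x∈ , x∉) → next⊆ b x∈ , λ x∈W → x∉ (next-bag b x∈ (∈-++⁺ˡ x∈W))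

  step : (s : Piece) → Step s
  step s with lem {P = ∃ (Fresh s)} | ℕ.<-≤-connex (length (W s)) cap
  ... | no none | _       = finish s none
  ... | yes some | inj₁ W< = pad s W< some
  ... | yes _    | inj₂ W≥ = separate s W≥

  private
    module At (s : Piece) = Step (step s)

  componentPiece : V → Piece
  componentPiece r = record
    { U = λ x → rep x ≡ r; W = []; W⊆U = λ (); W-uniq = []; W≤ = z≤n
    ; root = λ x∈ y∈ → trans x∈ (sym y∈) }

  private
    -- The state nothing is the root, whose children are the components of G.
    Part : Maybe Piece → Pred V ℓ
    Part nothing  _ = Poly.⊤
    Part (just s) x = U s x

    Bag : Maybe Piece → Pred V ℓ
    Bag nothing  _ = Empty.⊥
    Bag (just s) x = x ∈ₗ At.bag s

    child : Maybe Piece → V ⊎ Bool → Maybe Piece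
    child nothing  (inj₁ r) = just (componentPiece r)
    child nothing  (inj₂ _) = just empty
    child (just _) (inj₁ _) = just empty
    child (just s) (inj₂ b) = just (At.next s b)

    bag⊆ : ∀ s {x} → Bag s x → Part s x
    bag⊆ (just s) = At.bag⊆U s

    child⊆ : ∀ s i {x} → Part (child s i) x → Part s x
    child⊆ nothing  _        _  = _
    child⊆ (just _) (inj₁ _) ()
    child⊆ (just s) (inj₂ b) x∈ = At.next⊆ s b x∈

    child-bag : ∀ s i {x} → Part (child s i) x → Bag s x → Bag (child s i) x
    child-bag nothing  _        _  ()
    child-bag (just _) (inj₁ _) ()
    child-bag (just s) (inj₂ b) x∈ x∈bag = At.W⊆bag (At.next s b) (At.next-bag s b x∈ x∈bag)

    disjoint : ∀ s {i j x} → i ≢ j → Part (child s i) x → Part (child s j) x → Bag s x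
    disjoint nothing  {inj₁ _} {inj₁ _}        i≢j refl refl = contradiction refl i≢j
    disjoint nothing  {inj₁ _} {inj₂ _}        i≢j _ ()
    disjoint (just _) {inj₂ _} {inj₁ _}        i≢j _ ()
    disjoint (just _) {inj₂ true} {inj₂ true}  i≢j _ _ = contradiction refl i≢j
    disjoint (just s) {inj₂ true} {inj₂ false} i≢j x∈ y∈ = At.disjoint s x∈ y∈
    disjoint (just s) {inj₂ false} {inj₂ true} i≢j x∈ y∈ = At.disjoint s y∈ x∈
    disjoint (just _) {inj₂ false} {inj₂ false} i≢j _ _ = contradiction refl i≢j

  scheme : Scheme G (V ⊎ Bool) (Level.suc ℓ)
  scheme = record
    { State = Maybe Piece; start = nothing; child = child; Part = Part; Bag = Bag
    ; bag⊆ = bag⊆; child⊆ = child⊆; child-bag = child-bag; disjoint = disjoint }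

  open Scheme scheme using (state; Captures)

  -- The descent follows the child whose part contains both ends. An end outside the boundary is
  -- fresh, so the measure drops; once both ends are in the boundary, they share the bag.
  captures : Captures
  captures {u} {v} e = descend (suc (measure (componentPiece (rep u)) xs))
      (inj₁ (rep u) ∷ []) (componentPiece (rep u)) refl refl (sym rep≡) (ℕ.n<1+n _)
    where
    joined : u ≡ v ⊎ u ~ v → ∀ {n w} → Ball _~_ n w u → Ball _~_ (suc n) w v
    joined (inj₁ refl) b = Ball-mono (ℕ.n≤1+n _) b
    joined (inj₂ e)    b = b ∷ʳ e

    rep≡ : rep u ≡ rep v
    rep≡ = rep-cong (1 , joined e centre)

    n = proj₁ (rep-joined u)

    u-near : Ball _~_ (suc n) (rep u) u
    u-near = Ball-mono (ℕ.n≤1+n n) (proj₂ (rep-joined u))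

    v-near : Ball _~_ (suc n) (rep v) v
    v-near = subst (λ r → Ball _~_ (suc n) r v) rep≡ (joined e (proj₂ (rep-joined u)))

    -- Radius `suc n` reaches both ends, as `v` is at most one step further than `u`, and it is
    -- positive as `growth` demands.
    ball = growth (suc n) (rep u)
    xs = proj₁ ball

    ball⊆ : ∀ {r} → rep u ≡ r → ∀ {y} → Ball _~_ (suc n) r y → y ∈ₗ xs
    ball⊆ refl = proj₁ (proj₂ ball)

    descend : ∀ fuel p s → state p ≡ just s → U s u → U s v → measure s xs < fuel →
      ∃ λ q → Bag (state q) u × Bag (state q) v
    descend (suc fuel) p s p≡s u∈ v∈ (s≤s le)
      with At.cover s u∈ v∈ e | lem {P = u ∈ₗ W s} | lem {P = v ∈ₗ W s}
    ... | inj₁ (u∈bag , v∈bag) | _ | _ = p , subst (λ t → Bag t u × Bag t v) (sym p≡s) (u∈bag , v∈bag)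
    ... | inj₂ _ | yes u∈W | yes v∈W =
      p , subst (λ t → Bag t u × Bag t v) (sym p≡s) (At.W⊆bag s u∈W , At.W⊆bag s v∈W)
    ... | inj₂ (b , u∈′ , v∈′) | no u∉W | _ =
      descend fuel (inj₂ b ∷ p) (At.next s b) (cong (λ t → child t (inj₂ b)) p≡s) u∈′ v∈′
        (ℕ.<-≤-trans (At.progress s (ball⊆ refl) u-near (u∈ , u∉W) b) le)
    ... | inj₂ (b , u∈′ , v∈′) | yes _ | no v∉W =
      descend fuel (inj₂ b ∷ p) (At.next s b) (cong (λ t → child t (inj₂ b)) p≡s) u∈′ v∈′
        (ℕ.<-≤-trans (At.progress s (ball⊆ rep≡) v-near (v∈ , v∉W) b) le)

  linear-growth-decomposition : Σ (TreeDecomposition G) λ D → ∀ x →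
    ∃ λ n → HasFiniteSize (TreeDecomposition.bag D x) n × n ≤ capacity C + 2 * C
  linear-growth-decomposition = SchemeTree.decomposition lem scheme captures , λ p → size (state p)
    where
    size : ∀ s → ∃ λ n → HasFiniteSize (Bag s) n × n ≤ cap + 2 * C
    size nothing = 0 , ([] , [] , (λ x → mk⇔ (λ ()) λ ()) , refl) , z≤n
    size (just s) with finite-subset (λ x → x ∈ₗ At.bag s) (At.bag s) id
    ... | n , fin , n≤ = n , fin , ℕ.≤-trans n≤
          (ℕ.≤-trans (length-filter (decide λ x → x ∈ₗ At.bag s) (At.bag s)) (At.bag≤ s))

-- Integers among the rationals.

-- The rational i / 1 is opaque, as otherwise unification runs into the gcd
-- of its normalisation.
opaque
  ι : ℤ → ℚ
  ι i = i ℚ./ 1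

  ι-mk : ∀ i → ℚ.toℚᵘ (ι i) ℚᵘ.≃ mkℚᵘ i 0
  ι-mk i = ℚ.toℚᵘ-fromℚᵘ (mkℚᵘ i 0)

  ι-+ : ∀ i j → ι (i ℤ.+ j) ≡ ι i ℚ.+ ι j
  ι-+ i j = ℚ.toℚᵘ-injective (begin
    ℚ.toℚᵘ (ι (i ℤ.+ j))                ≈⟨ ι-mk (i ℤ.+ j) ⟩
    mkℚᵘ (i ℤ.+ j) 0                    ≈⟨ *≡* (eq i j) ⟩
    mkℚᵘ i 0 ℚᵘ.+ mkℚᵘ j 0              ≈⟨ ℚᵘ.+-cong (ι-mk i) (ι-mk j) ⟨
    ℚ.toℚᵘ (ι i) ℚᵘ.+ ℚ.toℚᵘ (ι j)      ≈⟨ ℚ.toℚᵘ-homo-+ (ι i) (ι j) ⟨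
    ℚ.toℚᵘ (ι i ℚ.+ ι j)                ∎)
    where
    open ℚᵘ.≃-Reasoning
    eq : ∀ i j → (i ℤ.+ j) ℤ.* + 1 ≡ (i ℤ.* + 1 ℤ.+ j ℤ.* + 1) ℤ.* + 1
    eq = ℤSolver.solve-∀

  ιℤ-* : ∀ i j → ι (i ℤ.* j) ≡ ι i ℚ.* ι j
  ιℤ-* i j = ℚ.toℚᵘ-injective (begin
    ℚ.toℚᵘ (ι (i ℤ.* j))                ≈⟨ ι-mk (i ℤ.* j) ⟩
    mkℚᵘ (i ℤ.* j) 0                    ≈⟨ ℚᵘ.≃-refl ⟩
    mkℚᵘ i 0 ℚᵘ.* mkℚᵘ j 0              ≈⟨ ℚᵘ.*-cong (ι-mk i) (ι-mk j) ⟨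
    ℚ.toℚᵘ (ι i) ℚᵘ.* ℚ.toℚᵘ (ι j)      ≈⟨ ℚ.toℚᵘ-homo-* (ι i) (ι j) ⟨
    ℚ.toℚᵘ (ι i ℚ.* ι j)                ∎)
    where open ℚᵘ.≃-Reasoning

  ι-mono : ∀ {i j} → i ℤ.≤ j → ι i ℚ.≤ ι j
  ι-mono {i} {j} i≤j = ℚ.toℚᵘ-cancel-≤ (begin
    ℚ.toℚᵘ (ι i)  ≃⟨ ι-mk i ⟩
    mkℚᵘ i 0      ≤⟨ *≤* (ℤ.*-monoʳ-≤-nonNeg (+ 1) i≤j) ⟩
    mkℚᵘ j 0      ≃⟨ ι-mk j ⟨
    ℚ.toℚᵘ (ι j)  ∎)
    where open ℚᵘ.≤-Reasoning

  ι-cancel : ∀ {i j} → ι i ℚ.≤ ι j → i ℤ.≤ j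
  ι-cancel {i} {j} le = ℤ.*-cancelʳ-≤-pos i j (+ 1) (ℚᵘ.drop-*≤* (begin
    mkℚᵘ i 0      ≃⟨ ι-mk i ⟨
    ℚ.toℚᵘ (ι i)  ≤⟨ ℚ.toℚᵘ-mono-≤ le ⟩
    ℚ.toℚᵘ (ι j)  ≃⟨ ι-mk j ⟩
    mkℚᵘ j 0      ∎))
    where open ℚᵘ.≤-Reasoning

  ι-def : ∀ i → i ℚ./ 1 ≡ ι i
  ι-def i = refl

ι-* : ∀ m n → ι (+ (m * n)) ≡ ι (+ m) ℚ.* ι (+ n)
ι-* m n = trans (cong ι (ℤ.pos-* m n)) (ιℤ-* (+ m) (+ n))

ι-suc : ∀ n → ι (+ n) ℚ.+ 1ℚ ≡ ι (+ (n + 1))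
ι-suc n = trans (cong (ι (+ n) ℚ.+_) (ι-def (+ 1))) (sym (ι-+ (+ n) (+ 1)))

p≤p+q : ∀ p q → .{{ℚ.NonNegative q}} → p ℚ.≤ p ℚ.+ q
p≤p+q p q = subst (ℚ._≤ p ℚ.+ q) (ℚ.+-identityʳ p) (ℚ.+-monoʳ-≤ p (ℚ.nonNegative⁻¹ q))

ι-nonNeg : ∀ n → ℚ.NonNegative (ι (+ n))
ι-nonNeg n = ℚ.nonNegative (subst (ℚ._≤ ι (+ n)) (sym (ι-def (+ 0))) (ι-mono (ℤ.+≤+ z≤n)))

-- From a real slope to an integer slope.

Eventually : Pred ℚ p → ℝ → Set p
Eventually P x = ∃ λ N → ∀ n → N ≤ n → P (seq x n)

eventually-× : ∀ {P : Pred ℚ p} {Q : Pred ℚ q} x →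
  Eventually P x → Eventually Q x → ∃ λ y → P y × Q y
eventually-× x (M , Px) (N , Qx) =
  seq x (M ℕ.⊔ N) , Px _ (ℕ.m≤m⊔n M N) , Qx _ (ℕ.m≤n⊔m M N)

private
  0<1 : 0ℚ ℚ.< 1ℚ
  0<1 = ℚ.positive⁻¹ 1ℚ

-- Late terms are within 1 of a fixed term, and a rational is at most the absolute value of its
-- numerator.
eventually-≤ℕ : ∀ x → ∃ λ n → Eventually (ℚ._≤ ι (+ n)) x
eventually-≤ℕ x with cauchy x 1ℚ 0<1
... | N , close = n , N , λ m N≤m → begin
    seq x m                              ≡⟨ eq (seq x m) (seq x N) ⟩
    seq x N ℚ.+ (seq x m ℚ.- seq x N)    ≤⟨ ℚ.+-mono-≤ (proj₂ above)
      (ℚ.≤-trans p≤∣p∣ (close m N N≤m ℕ.≤-refl)) ⟩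
    ι (+ proj₁ above) ℚ.+ 1ℚ             ≡⟨ ι-suc (proj₁ above) ⟩
    ι (+ n)                              ∎
  where
  open ℚ.≤-Reasoning
  p≤∣p∣ : ∀ {p} → p ℚ.≤ ℚ.∣ p ∣
  p≤∣p∣ {p} with ℚ.≤-total 0ℚ p
  ... | inj₁ 0≤p = ℚ.≤-reflexive (sym (ℚ.0≤p⇒∣p∣≡p 0≤p))
  ... | inj₂ p≤0 = ℚ.≤-trans p≤0 (ℚ.0≤∣p∣ p)
  eq : ∀ p q → p ≡ q ℚ.+ (p ℚ.- q)
  eq = solve 2 (λ p q → p := q :+ (p :+ (:- q))) refl
    where open +-*-Solver
  above : ∃ λ k → seq x N ℚ.≤ ι (+ k)
  above = ℤ.∣ ℚ.↥ seq x N ∣ , ℚ.toℚᵘ-cancel-≤ (≤-numerator (seq x N))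
    where
    ≤-numerator : ∀ q → ℚ.toℚᵘ q ℚᵘ.≤ ℚ.toℚᵘ (ι (+ ℤ.∣ ℚ.↥ q ∣))
    ≤-numerator q@(ℚ.mkℚ i d _) = ℚᵘ.≤-trans (*≤* (at i))
      (ℚᵘ.≤-reflexive (ℚᵘ.≃-sym (ι-mk (+ ℤ.∣ i ∣))))
      where
      at : ∀ i → i ℤ.* + 1 ℤ.≤ + ℤ.∣ i ∣ ℤ.* + suc d
      at (+ n) = subst₂ ℤ._≤_ (sym (ℤ.*-identityʳ (+ n))) (ℤ.pos-* n (suc d))
        (ℤ.+≤+ (ℕ.m≤m*n n (suc d)))
      at ℤ.-[1+ n ] = ℤ.-≤+
  n = proj₁ above + 1

module _ (c : ℝ) where

  GrowsAt : ℕ → ℕ → Set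
  GrowsAt r n = fromℤ (+ n) ≤ℝ c *ℝ fromℤ (+ r)

  private
    with-error : ∀ {r n} → GrowsAt r n → Eventually (λ x → ι (+ n) ℚ.≤ x ℚ.* ι (+ r) ℚ.+ 1ℚ) c
    with-error {r} {n} grows with grows 1ℚ 0<1
    ... | N , n≤ = N , λ j N≤j →
      subst₂ (λ p q → p ℚ.≤ seq c j ℚ.* q ℚ.+ 1ℚ) (ι-def (+ n)) (ι-def (+ r)) (n≤ j N≤j)

  integral-bound : ∀ {r n K} → GrowsAt r n → Eventually (ℚ._≤ ι (+ K)) c → n ≤ K * r + 1
  integral-bound {r} {n} {K} grows c≤K with eventually-×
      {P = λ x → ι (+ n) ℚ.≤ x ℚ.* ι (+ r) ℚ.+ 1ℚ} {Q = ℚ._≤ ι (+ K)}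
      c (with-error {r} {n} grows) c≤K
  ... | x , n≤ , x≤K = ℤ.drop‿+≤+ (ι-cancel (begin
    ι (+ n)                        ≤⟨ n≤ ⟩
    x ℚ.* ι (+ r) ℚ.+ 1ℚ           ≤⟨ ℚ.+-monoˡ-≤ 1ℚ (ℚ.*-monoʳ-≤-nonNeg (ι (+ r)) {{ι-nonNeg r}} x≤K) ⟩
    ι (+ K) ℚ.* ι (+ r) ℚ.+ 1ℚ     ≡⟨ cong (ℚ._+ 1ℚ) (ι-* K r) ⟨
    ι (+ (K * r)) ℚ.+ 1ℚ           ≡⟨ ι-suc (K * r) ⟩
    ι (+ (K * r + 1))              ∎))
    where open ℚ.≤-Reasoning

  -- Integrality turns `K * r < n` into `K * r + 1 ≤ n`, which absorbs the error 1 in the comparison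
  -- with `c`.
  excess-bound : ∀ {r n K} .{{_ : NonZero r}} → GrowsAt r n → K * r < n → Eventually (ι (+ K) ℚ.≤_) c
  excess-bound {suc r-1} {n} {K} grows Kr<n with with-error {suc r-1} {n} grows
  ... | N , n≤ = N , λ j N≤j → cancel (seq c j) (n≤ j N≤j)
    where
    open ℚ.≤-Reasoning
    r = suc r-1
    cancel : ∀ x → ι (+ n) ℚ.≤ x ℚ.* ι (+ r) ℚ.+ 1ℚ → ι (+ K) ℚ.≤ x
    cancel x le = ℚ.*-cancelʳ-≤-pos (ι (+ r)) {{pos}} (+1-cancel (begin
      ι (+ K) ℚ.* ι (+ r) ℚ.+ 1ℚ     ≡⟨ cong (ℚ._+ 1ℚ) (ι-* K r) ⟨
      ι (+ (K * r)) ℚ.+ 1ℚ           ≡⟨ ι-suc (K * r) ⟩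
      ι (+ (K * r + 1))              ≤⟨ ι-mono (ℤ.+≤+ (subst (_≤ n) (ℕ.+-comm 1 (K * r)) Kr<n)) ⟩
      ι (+ n)                        ≤⟨ le ⟩
      x ℚ.* ι (+ r) ℚ.+ 1ℚ           ∎))
      where
      pos : ℚ.Positive (ι (+ r))
      pos = ℚ.positive (ℚ.<-≤-trans 0<1 (subst (ℚ._≤ ι (+ r)) (sym (ι-def (+ 1))) (ι-mono (ℤ.+≤+ (s≤s z≤n)))))
      +1-cancel : ∀ {p q} → p ℚ.+ 1ℚ ℚ.≤ q ℚ.+ 1ℚ → p ℚ.≤ q
      +1-cancel {p} {q} le = ℚ.≮⇒≥ λ q<p → ℚ.<-irrefl refl (ℚ.<-≤-trans (ℚ.+-monoˡ-< 1ℚ q<p) le)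

  HalfBelow : ℕ → Set
  HalfBelow C = Eventually (λ x → ι (+ C) ℚ.≤ x ℚ.+ x) c

  private
    -- With an error of ½ in `1 ≤ c`, late terms are at least ½, and their doubles reach 1.
    half-below-1 : fromℤ (+ 1) ≤ℝ c → HalfBelow 1
    half-below-1 1≤c with 1≤c ½ (ℚ.positive⁻¹ ½)
    ... | N , le = N , λ n N≤n → double (seq c n) (le n N≤n)
      where
      double : ∀ x → 1ℚ ℚ.≤ x ℚ.+ ½ → ι (+ 1) ℚ.≤ x ℚ.+ x
      double x 1≤ = subst (ℚ._≤ x ℚ.+ x) (ι-def (+ 1)) (ℚ.+-mono-≤ ½≤x ½≤x)
        where
        ½≤x : ½ ℚ.≤ x
        ½≤x = ℚ.≮⇒≥ λ x<½ → ℚ.<-irrefl refl (ℚ.<-≤-trans (ℚ.+-monoˡ-< ½ x<½) 1≤)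

    half-below-suc : ∀ M → Eventually (ι (+ suc M) ℚ.≤_) c → HalfBelow (suc (suc M))
    half-below-suc M (N , le) = N , λ n N≤n → double (seq c n) (le n N≤n)
      where
      open ℚ.≤-Reasoning
      double : ∀ x → ι (+ suc M) ℚ.≤ x → ι (+ suc (suc M)) ℚ.≤ x ℚ.+ x
      double x M≤x = begin
        ι (+ suc (suc M))                ≤⟨ ι-mono (ℤ.+≤+ (s≤s (ℕ.m≤n+m (suc M) M))) ⟩
        ι (+ (suc M + suc M))            ≡⟨ ι-+ (+ suc M) (+ suc M) ⟩
        ι (+ suc M) ℚ.+ ι (+ suc M)      ≤⟨ ℚ.+-mono-≤ M≤x M≤x ⟩
        x ℚ.+ x                          ∎

  -- Let C = M + 1 be least such that f r ≤ C r for all r.  Either M = 0, or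
  -- M r < f r for some r and then M ≤ c; in both cases C ≤ 2 c.
  integral-slope : (∀ {a} → ExcludedMiddle a) → fromℤ (+ 1) ≤ℝ c →
    (F : ∀ r → .{{NonZero r}} → ℕ) → (∀ r .{{_ : NonZero r}} → GrowsAt r (F r)) →
    ∃ λ M → (∀ r .{{_ : NonZero r}} → F r ≤ suc M * r) × HalfBelow (suc M)
  integral-slope lem 1≤c F grows = slope (least Bounds (proj₁ bounded , bounds))
    where
    open Classical lem using (stable; least; IsLeast)
    Bounds : ℕ → Set
    Bounds M = ∀ r .{{_ : NonZero r}} → F r ≤ suc M * r
    bounded : ∃ λ n → Eventually (ℚ._≤ ι (+ n)) c
    bounded = eventually-≤ℕ c
    bounds : Bounds (proj₁ bounded)
    bounds r = let K = proj₁ bounded in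
      -- As `r` is positive, one more unit of slope pays for the error 1.
      ℕ.≤-trans (integral-bound {r} {F r} {K} (grows r) (proj₂ bounded))
        (ℕ.≤-trans (ℕ.+-monoʳ-≤ (K * r) (ℕ.>-nonZero⁻¹ r)) (ℕ.≤-reflexive (ℕ.+-comm (K * r) r)))
    fails : ∀ M → ¬ Bounds M → ∃ λ r → Σ (NonZero r) λ r≢0 → suc M * r < F r {{r≢0}}
    fails M ¬bounds = stable λ none → ¬bounds λ r {{r≢0}} →
      ℕ.≮⇒≥ λ lt → none (r , recompute r r≢0 , lt)
      where
      -- The positivity proof is irrelevant, so it is rebuilt from `r` before it is returned as
      -- data.
      recompute : ∀ r → .(NonZero r) → NonZero r
      recompute (suc r) _ = _
    slope : ∃ (IsLeast Bounds) → ∃ λ M → Bounds M × HalfBelow (suc M)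
    slope (zero  , bound , _)   = zero , bound , half-below-1 1≤c
    slope (suc M , bound , min) = suc M , bound , half-below-suc M (large (fails M λ b → ℕ.1+n≰n (min M b)))
      where
      large : (∃ λ r → Σ (NonZero r) λ r≢0 → suc M * r < F r {{r≢0}}) → Eventually (ι (+ suc M) ℚ.≤_) c
      large (r , r≢0 , lt) = excess-bound {r} {F r {{r≢0}}} {suc M} {{r≢0}} (grows r {{r≢0}}) lt

  -- The estimate holds at each late term `x`: from `C ≤ 2 x` it follows that `x` is non-negative,
  -- which makes squaring monotone and lets the coefficients 40 and 8 be raised to 49 and 30.
  quadratic-bound : ∀ {C} i → i ℤ.≤ + (10 * (C * C) + 4 * C) → HalfBelow C →
    fromℤ i ≤ℝ fromℤ (+ 49) *ℝ (c *ℝ c) +ℝ fromℤ (+ 30) *ℝ c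
  quadratic-bound {C} i i≤ (N , half) ε 0<ε = N , λ n N≤n →
    subst₂ ℚ._≤_ (sym (ι-def i))
      (sym (cong₂ (λ p q → p ℚ.* (seq c n ℚ.* seq c n) ℚ.+ q ℚ.* seq c n ℚ.+ ε) (ι-def (+ 49)) (ι-def (+ 30))))
      (bound (seq c n) (half n N≤n))
    where
    open ℚ.≤-Reasoning
    z = ι (+ C)
    z≥0 : ℚ.NonNegative z
    z≥0 = ι-nonNeg C
    square : ∀ p x → p ℚ.* ((x ℚ.+ x) ℚ.* (x ℚ.+ x)) ≡ (p ℚ.+ p ℚ.+ (p ℚ.+ p)) ℚ.* (x ℚ.* x)
    square = solve 2 (λ p x → p :* ((x :+ x) :* (x :+ x)) := (p :+ p :+ (p :+ p)) :* (x :* x)) refl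
      where open +-*-Solver
    linear : ∀ p x → p ℚ.* (x ℚ.+ x) ≡ (p ℚ.+ p) ℚ.* x
    linear = solve 2 (λ p x → p :* (x :+ x) := (p :+ p) :* x) refl
      where open +-*-Solver
    twice : ∀ n → ι (+ n) ℚ.+ ι (+ n) ≡ ι (+ (n + n))
    twice n = sym (ι-+ (+ n) (+ n))
    expand : ι (+ (10 * (C * C) + 4 * C)) ≡ ι (+ 10) ℚ.* (z ℚ.* z) ℚ.+ ι (+ 4) ℚ.* z
    expand = trans (ι-+ (+ (10 * (C * C))) (+ (4 * C)))
      (cong₂ ℚ._+_ (trans (ι-* 10 (C * C)) (cong (ι (+ 10) ℚ.*_) (ι-* C C))) (ι-* 4 C))
    bound : ∀ x → z ℚ.≤ x ℚ.+ x → ι i ℚ.≤ ι (+ 49) ℚ.* (x ℚ.* x) ℚ.+ ι (+ 30) ℚ.* x ℚ.+ ε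
    bound x z≤y = begin
      ι i                                            ≤⟨ ι-mono i≤ ⟩
      ι (+ (10 * (C * C) + 4 * C))                   ≡⟨ expand ⟩
      ι (+ 10) ℚ.* (z ℚ.* z) ℚ.+ ι (+ 4) ℚ.* z
        ≤⟨ ℚ.+-mono-≤ (ℚ.*-monoˡ-≤-nonNeg (ι (+ 10)) {{ι-nonNeg 10}} zz≤yy)
                      (ℚ.*-monoˡ-≤-nonNeg (ι (+ 4)) {{ι-nonNeg 4}} z≤y) ⟩
      ι (+ 10) ℚ.* (y ℚ.* y) ℚ.+ ι (+ 4) ℚ.* y       ≡⟨ cong₂ ℚ._+_ fold₄₀ fold₈ ⟩
      ι (+ 40) ℚ.* (x ℚ.* x) ℚ.+ ι (+ 8) ℚ.* x
        ≤⟨ ℚ.+-mono-≤ (ℚ.*-monoʳ-≤-nonNeg (x ℚ.* x) {{xx≥0}} (ι-mono (ℤ.+≤+ (ℕ.m≤m+n 40 9))))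
                      (ℚ.*-monoʳ-≤-nonNeg x {{x≥0}} (ι-mono (ℤ.+≤+ (ℕ.m≤m+n 8 22)))) ⟩
      ι (+ 49) ℚ.* (x ℚ.* x) ℚ.+ ι (+ 30) ℚ.* x
        ≤⟨ p≤p+q _ ε {{ℚ.nonNegative (ℚ.<⇒≤ 0<ε)}} ⟩
      ι (+ 49) ℚ.* (x ℚ.* x) ℚ.+ ι (+ 30) ℚ.* x ℚ.+ ε ∎
      where
      y = x ℚ.+ x
      0≤y : 0ℚ ℚ.≤ y
      0≤y = ℚ.≤-trans (ℚ.nonNegative⁻¹ z {{z≥0}}) z≤y
      x≥0 : ℚ.NonNegative x
      x≥0 = ℚ.nonNegative (ℚ.≮⇒≥ λ x<0 → ℚ.<-irrefl refl (ℚ.<-≤-trans (ℚ.+-mono-< {x} {0ℚ} {x} {0ℚ} x<0 x<0) 0≤y))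
      xx≥0 : ℚ.NonNegative (x ℚ.* x)
      xx≥0 = ℚ.nonNeg*nonNeg⇒nonNeg x {{x≥0}} x {{x≥0}}
      zz≤yy : z ℚ.* z ℚ.≤ y ℚ.* y
      zz≤yy = ℚ.≤-trans (ℚ.*-monoˡ-≤-nonNeg z {{z≥0}} z≤y)
        (ℚ.*-monoʳ-≤-nonNeg y {{ℚ.nonNegative 0≤y}} z≤y)
      fold₄₀ : ι (+ 10) ℚ.* (y ℚ.* y) ≡ ι (+ 40) ℚ.* (x ℚ.* x)
      fold₄₀ = trans (square (ι (+ 10)) x) (cong (ℚ._* (x ℚ.* x))
        (trans (cong₂ ℚ._+_ (twice 10) (twice 10)) (twice 20)))
      fold₈ : ι (+ 4) ℚ.* y ≡ ι (+ 8) ℚ.* x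
      fold₈ = trans (linear (ι (+ 4)) x) (cong (ℚ._* x) (twice 4))

-- Ball sizes from the growth function, and existence of the treewidth.

HasFiniteSize-≤ : ∀ (lem : ∀ {a} → ExcludedMiddle a) {A : Set a} {P : Pred A p} {m n} →
  HasFiniteSize P m → HasFiniteSize P n → m ≤ n
HasFiniteSize-≤ lem (xs , xs! , xs⇔ , refl) (ys , _ , ys⇔ , refl) =
  Classical.unique-length lem xs! λ x∈ → Equivalence.to (ys⇔ _) (Equivalence.from (xs⇔ _) x∈)

-- Every vertex along a path of length at most `r` from `v` is itself in the ball, so the path
-- survives in the induced subgraph.
ball-radius : (G : Graph ℓ) → ∀ r v →
  RadiusAtMost (induced G (Ball (Graph._~_ G) r v)) r
ball-radius G r v = v , centre , λ x b → ball⇒walk (restrict b ℕ.≤-refl)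
  where
  open Graph G using (_~_)
  restrict : ∀ {n x} → Ball _~_ n v x → n ≤ r →
    Ball (Subgraph.E (induced G (Ball _~_ r v))) n v x
  restrict centre   _   = centre
  restrict (b ∷ʳ e) n<r = restrict b (ℕ.<⇒≤ n<r) ∷ʳ
    (Ball-mono (ℕ.<⇒≤ n<r) b , Ball-mono n<r (b ∷ʳ e) , e)

module Growth (lem : ∀ {a} → ExcludedMiddle a) {G : Graph ℓ}
              {f : ∀ r → .{{NonZero r}} → ℕ ⁺} (isGrowth : IsGrowth G f) where

  ball-size : ∀ r v n .{{_ : NonZero r}} → f r ≡ [ n ] →
    ∃ λ xs → (∀ {x} → Ball (Graph._~_ G) r v x → x ∈ₗ xs) × length xs ≤ n
  ball-size r v n fr≡n = size lem
    where
    B = Ball (Graph._~_ G) r v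
    bounded : ∀ {s} → HasSize B s → s ≤ℕ⁺ [ n ]
    bounded {s} sz = subst (s ≤ℕ⁺_) fr≡n
      (proj₁ (isGrowth r) s (induced G B , ball-radius G r v , sz))
    size : Dec (∃ (HasFiniteSize B)) →
      ∃ λ xs → (∀ {x} → B x → x ∈ₗ xs) × length xs ≤ n
    size (yes (m , fin@(xs , _ , xs⇔ , refl))) =
      xs , Equivalence.to (xs⇔ _) , [≤]-injective (bounded {[ m ]} fin)
    size (no infinite) with bounded {⊤⁺} infinite
    ... | ()

  linear : ∀ {C} (F : ∀ r → .{{NonZero r}} → ℕ) → (∀ r .{{_ : NonZero r}} → f r ≡ [ F r ]) →
    (∀ r .{{_ : NonZero r}} → F r ≤ C * r) → LinearGrowth (Graph._~_ G) C
  linear F f≡F F≤ r v = let xs , ball⊆ , xs≤ = ball-size r v (F r) (f≡F r)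
                        in xs , ball⊆ , ℕ.≤-trans xs≤ (F≤ r)

module Treewidth (lem : ∀ {a} → ExcludedMiddle a) {G : Graph ℓ} where
  open Classical lem
  open TreeDecomposition

  BagsBounded : TreeDecomposition G → ℕ → Set ℓ
  BagsBounded D b = ∀ x → ∃ λ n → HasFiniteSize (bag D x) n × n ≤ b

  -- The tree has a node, so some bag size exists, and bounded sizes attain a maximum.
  maximum-bag : ∀ {D b} → BagsBounded D b → ∃ λ m → IsMaximum (BagSize D) [ m ] × m ≤ b
  maximum-bag {D} {b} bounded =
    let t , _ = proj₁ (T-tree D)
        n , size , _ = bounded t
        m , attained , above = greatest (λ n → BagSize D [ n ]) (n , t , size) b ≤b
    in m , (attained , upper above) , ≤b m attained
    where
    ≤b : ∀ n → BagSize D [ n ] → n ≤ b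
    ≤b n (x , size) = let _ , size′ , n′≤b = bounded x
                      in ℕ.≤-trans (HasFiniteSize-≤ lem size size′) n′≤b
    upper : ∀ {m} → (∀ n → BagSize D [ n ] → n ≤ m) → IsUpperBound (BagSize D) [ m ]
    upper above [ n ] size       = [ above n size ]
    upper above ⊤⁺    (x , infinite) = let n , size , _ = bounded x
                                       in contradiction (n , size) infinite

  -- The maximum bag size, a natural number, is minimised over all decompositions; one is subtracted
  -- only afterwards, as widths may be negative.
  treewidth-≤ : ∀ {D b} → BagsBounded D b → ∃ λ m → IsTreewidth G [ + m ℤ.- + 1 ] × m ≤ b
  treewidth-≤ {D} bounded =
    let m₀ , max₀ , m₀≤b = maximum-bag {D} bounded
        m , (D′ , max) , min = least (λ m → Σ (TreeDecomposition G) λ D → IsMaximum (BagSize D) [ m ])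
                                 (m₀ , D , max₀)
    in m , ((D′ , m , max , refl) ,
            λ { D″ _ (m″ , max″ , refl) → ℤ.+-monoˡ-≤ (ℤ.- + 1) (ℤ.+≤+ (min m″ (D″ , max″))) }) ,
       ℕ.≤-trans (min m₀ (D , max₀)) m₀≤b

-- The treewidth bound for a real slope.

theorem1 : (∀ {a} → ExcludedMiddle a) → (∀ {a b} → Extensionality a b) →
    ∀ {ℓ} (c : ℝ) → fromℤ (+ 1) ≤ℝ c →
    (G : Graph ℓ) (f : ∀ r → .{{NonZero r}} → ℕ ⁺) → IsGrowth G f →
    (∀ r → .{{_ : NonZero r}} →
      map (λ n → fromℤ (+ n)) (f r) ≤ℝ⁺ [ c *ℝ fromℤ (+ r) ]) →
    ∃ λ (t : ℤ ⁺) → IsTreewidth G t ×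
      map fromℤ t ≤ℝ⁺
        [ fromℤ (+ 49) *ℝ (c *ℝ c) +ℝ fromℤ (+ 30) *ℝ c ]
theorem1 lem ext c 1≤c G f isGrowth f≤ =
    [ + m ℤ.- + 1 ] , proj₁ (proj₂ tw) ,
    [ quadratic-bound c {C} (+ m ℤ.- + 1) m-1≤ (proj₂ (proj₂ slope)) ]
  where
  finite : ∀ r (s : ℕ ⁺) → map (λ n → fromℤ (+ n)) s ≤ℝ⁺ [ c *ℝ fromℤ (+ r) ] →
    ∃ λ n → s ≡ [ n ] × GrowsAt c r n
  finite r [ n ] [ n≤ ] = n , refl , n≤
  value : ∀ r .{{_ : NonZero r}} → ∃ λ n → f r ≡ [ n ] × GrowsAt c r n
  value r = finite r (f r) (f≤ r)
  F : ∀ r → .{{NonZero r}} → ℕ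
  F r = proj₁ (value r)
  slope = integral-slope c lem 1≤c F (λ r → proj₂ (proj₂ (value r)))
  C = suc (proj₁ slope)
  growth : LinearGrowth (Graph._~_ G) C
  growth = Growth.linear lem isGrowth {C} F (λ r → proj₁ (proj₂ (value r))) (proj₁ (proj₂ slope))
  D = Decompose.linear-growth-decomposition lem ext G {C} growth
  tw = Treewidth.treewidth-≤ lem {D = proj₁ D} (proj₂ D)
  m = proj₁ tw
  -- The final 1 cancels against the 1 subtracted in the width.
  size : ∀ C → suc (5 * C * (2 * C) + 2 * C) + 2 * C ≡ 10 * (C * C) + 4 * C + 1
  size = solve-∀
  m-1≤ : + m ℤ.- + 1 ℤ.≤ + (10 * (C * C) + 4 * C)
  m-1≤ = subst (+ m ℤ.- + 1 ℤ.≤_) (cancel (+ (10 * (C * C) + 4 * C)))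
    (ℤ.+-monoˡ-≤ (ℤ.- + 1) (ℤ.+≤+ (subst (m ≤_) (size C) (proj₂ (proj₂ tw)))))
    where
    cancel : ∀ i → i ℤ.+ + 1 ℤ.- + 1 ≡ i
    cancel = ℤSolver.solve-∀
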